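{- Let $\Delta,k$ be integers with $k\ge 1$, $\Delta\ge k+3$ and $\Delta$ even. Then there is a gadget, i.e. a realizable instance of $\Delta$-$k$-DiTTR (so that $D_{u,v}\ge\hat d(u,v)+k$ for all $u,v$), that enforces $\lambda(e_1,e_2)=\lambda(e_2,e_1)$ for some pair of adjacent vertices $(e_1,e_2)$.
   Context: All graphs are finite. A $\Delta$-periodic labeling of a directed graph $G=(V,E)$ is a map $\lambda:E\to\{0,1,\dots,\Delta-1\}$; edge $e$ is then active exactly at the times $\lambda(e)+i\Delta$, $i\in\mathbb{N}_0$. A temporal $s$-$z$-path is a sequence $(v_{i-1},v_i,t_i)_{i=1}^{\ell}$ with $v_0=s$, $v_\ell=z$, pairwise distinct vertices $v_0,\dots,v_\ell$, $(v_{i-1},v_i)\in E$ active at time $t_i$ for every $i$, and $t_1<t_2<\dots<t_\ell$ (strictly increasing). Its duration is $t_\ell+1-t_1$. A fastest temporal path is one of minimum duration. $\hat d(u,v)$ is the distance from $u$ to $v$ in the static graph $G$ (all edges have unit length). A bidirected tree is the directed graph obtained from an undirected tree by replacing each edge $\{u,v\}$ by the two directed edges $(u,v),(v,u)$ (which may get different labels). For integers $\Delta\ge1,k\ge0$, an instance of $\Delta$-$k$-DiTTR consists of a bidirected tree $G=(V,E)$ and a matrix $D$ indexed by $V\times V$ with entries positive integers or $\infty$ (no restriction) such that $D_{u,v}\ge\hat d(u,v)+k$ for all $u,v$. A valid labeling is a $\Delta$-periodic labeling $\lambda$ of $E$ such that, for all $u,v\in V$, the duration of a fastest temporal path from $u$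 to $v$ is at most $D_{u,v}$; the instance is realizable if a valid labeling exists. Diagonal entries of $D$ play no role; all conditions on $D$ are for distinct vertices. An instance enforces $\lambda(e_1,e_2)=\lambda(e_2,e_1)$ if this equality holds for every valid labeling $\lambda$. -}

module Defs where

open import Level using (0ℓ)
open import Data.Bool.Base using (Bool; false; T)
open import Data.Fin.Base as Fin using (Fin; zero; suc; fromℕ; inject₁; toℕ)
open import Data.Nat.Base using (ℕ; suc; _+_; _*_; _∸_; _≤_; _<_)
open import Data.Product.Base using (Σ; ∃; ∃-syntax; _×_)
open import Function.Bundles using (_↔_)
open import Function.Definitions using (Injective)
open import Relation.Binary.Core using (Rel)
open import Relation.Binary.PropositionalEquality.Core using (_≡_; _≢_)
open import Relation.Nullary.Negation.Core using (¬_)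
open import Relation.Nullary.Construct.Add.Supremum public using (_⁺; [_]; ⊤⁺)
open import Relation.Binary.Construct.Add.Supremum.NonStrict _≤_ public
  using (_≤⁺_)

record Digraph : Set₁ where
  field
    V      : Set
    finite : ∃[ n ] (V ↔ Fin n)
    edge   : V → V → Bool

  -- Proofs of T b are unique, so a function on edges cannot depend on them.
  Edge : Rel V 0ℓ
  Edge u v = T (edge u v)

record Graph : Set₁ where
  field
    V      : Set
    finite : ∃[ n ] (V ↔ Fin n)
    adj    : V → V → Bool
    symm   : ∀ u v → adj u v ≡ adj v u
    irrefl : ∀ v → adj v v ≡ false

  bidirected : Digraph
  bidirected = record { V = V ; finite = finite ; edge = adj }

module _ (G : Digraph) where
  open Digraph G

  -- The i-th edge leads from vertex (inject₁ i) to vertex (suc i).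
  record Path (ℓ : ℕ) (s z : V) : Set where
    field
      vertex   : Fin (suc ℓ) → V
      source   : vertex zero ≡ s
      target   : vertex (fromℕ ℓ) ≡ z
      distinct : Injective _≡_ _≡_ vertex
      edges    : ∀ (i : Fin ℓ) → Edge (vertex (inject₁ i)) (vertex (suc i))

  IsDistance : V → V → ℕ → Set
  IsDistance u v d = Path d u v × (∀ {ℓ} → Path ℓ u v → d ≤ ℓ)

  Labeling : ℕ → Set
  Labeling Δ = ∀ u v → Edge u v → Fin Δ

  module _ {Δ : ℕ} (lab : Labeling Δ) where

    Active : ∀ {u v} → Edge u v → ℕ → Set
    Active {u} {v} e t = ∃[ i ] t ≡ toℕ (lab u v e) + i * Δ

    -- At least one edge, since the duration refers to the first and last time.
    record TemporalPath (s z : V) : Set where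
      field
        {ℓ}        : ℕ
        path       : Path (suc ℓ) s z
        time       : Fin (suc ℓ) → ℕ
        active     : ∀ i → Active (Path.edges path i) (time i)
        increasing : ∀ {i j} → i Fin.< j → time i < time j

      duration : ℕ
      duration = time (fromℕ ℓ) + 1 ∸ time zero

    open TemporalPath public using (duration)

    Fastest : ∀ {s z} → TemporalPath s z → Set
    Fastest {s} {z} P = ∀ (Q : TemporalPath s z) → duration P ≤ duration Q

-- Acyclicity: no path with at least two edges is closed up by a further edge,
-- i.e. there is no cycle on at least three vertices.
record IsTree (G : Graph) : Set where
  open Graph G using (V; adj; bidirected)
  field
    connected : ∀ u v → ∃[ ℓ ] Path bidirected ℓ u v
    acyclic   : ∀ {ℓ u v} → Path bidirected (suc (suc ℓ)) u v → ¬ T (adj v u)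

-- ⊤⁺ plays the role of ∞.
record DiTTR (Δ k : ℕ) : Set₁ where
  field
    tree   : Graph
    isTree : IsTree tree

  G : Digraph
  G = Graph.bidirected tree

  open Digraph G public using (V; Edge)

  field
    D        : V → V → ℕ ⁺
    positive : ∀ u v → [ 1 ] ≤⁺ D u v
    slack    : ∀ u v → u ≢ v → ∃[ d ] (IsDistance G u v d × [ d + k ] ≤⁺ D u v)

  Valid : Labeling G Δ → Set
  Valid lab = ∀ u v → u ≢ v →
    Σ (TemporalPath G lab u v) λ P → Fastest G lab P × [ duration P ] ≤⁺ D u v

  Realizable : Set
  Realizable = ∃ Valid

  EnforcesEqual : V → V → Set
  EnforcesEqual e₁ e₂ = ∀ (lab : Labeling G Δ) → Valid lab →
    ∀ (e : Edge e₁ e₂) (e′ : Edge e₂ e₁) → lab e₁ e₂ e ≡ lab e₂ e₁ e′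

{-# OPTIONS --safe #-}
-- In a tree the temporal path between two vertices uses a unique route, so a labeling enters only
-- through the excess of each route: the sum of (waiting time - 1) over its inner vertices.  Put
-- K = Δ - 3 and let every pair of vertices grant the excess K.
--
-- Some tree admits no such labeling.  In a tall tower of high degree, the pigeonhole principle
-- yields leaves whose pendant edges carry the same two labels at all even distances from each
-- other.  The excesses of the routes between them run through all residues of one parity modulo Δ,
-- hence also through one of the residues -1 and -2, which exceed K.  A labeling of this tree that
-- minimises the total duration cap (the duration, but at least what the slack K grants) therefore
-- saturates some pair (p , q): a labeling that respects its caps cannot be faster from p to q.
--
-- A route through p and q then has no excess to spare outside of it.  In the gadget, two copies of
-- the tree are attached to a vertex o, one by q and the other by p, and a leg hangs off o that ends
-- in two leaves.  Through the saturated copies, the labels along the leg are forced to be successive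
-- in either direction, up to a single bit: the wait at o between the copies, which is 1 or 2.  For
-- the wait 1 the labels of the two directions differ by odd numbers, and since Δ is even, the length
-- of the leg can be chosen such that the turn between the two leaves is then too slow.  For the wait
-- 2 the two directions of the first edge of the leg carry the same label.
module Submission where

open import Defs
open import Data.Nat.Base using (ℕ; _+_; _≤_)
open import Data.Nat.Divisibility using (_∣_)
open import Data.Product.Base using (Σ; ∃-syntax; _×_)
open import Data.Bool.Base using (Bool; false; T; _∧_)
open import Data.Bool.Properties using (T-∧; T?; T-irrelevant)
open import Data.Empty using (⊥-elim)
open import Data.Fin.Base as Fin using (Fin; zero; suc; toℕ; fromℕ; inject₁; combine)
open import Data.Fin.Properties as Fin
  using (+↔⊎; 1↔⊤; toℕ<n; toℕ-injective; toℕ-fromℕ<; any?; pigeonhole; combine-injective)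
open import Data.List.Base using (List; []; _∷_; _++_; length; map; tabulate)
open import Data.List.Properties
  using (length-map; length-++; length-tabulate; tabulate-cong; map-++; ++-assoc)
open import Data.List.Membership.Propositional using (_∈_; _∉_)
open import Data.List.Membership.Propositional.Properties
  using (∈-map⁻; ∈-map⁺; ∈-++⁻; ∈-++⁺ˡ; ∈-tabulate⁻; ∈-tabulate⁺)
open import Data.List.Relation.Unary.Any using (here; there)
open import Data.Nat.Base
open import Data.Nat.Divisibility using (divides)
open import Data.Nat.DivMod
open import Data.Nat.Properties
open import Algebra.Properties.CommutativeSemigroup +-commutativeSemigroup using (xy∙z≈xz∙y)
open import Data.Product.Base using (_,_; ∃; proj₁; proj₂; swap)
open import Data.Sum.Base using (_⊎_; inj₁; inj₂)
open import Data.Sum.Function.Propositional using (_⊎-↔_)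
open import Data.Sum.Properties using (≡-dec; inj₁-injective; inj₂-injective)
open import Data.Unit.Base using (⊤; tt)
import Data.Unit.Properties as Unit
open import Function.Base using (_∘_; _on_; id)
open import Function.Bundles using (_↔_; Equivalence)
open import Function.Construct.Composition using (_↔-∘_)
open import Function.Construct.Symmetry using (↔-sym)
open import Relation.Binary.Construct.Add.Supremum.NonStrict _≤_ using ([_])
open import Relation.Binary.Definitions using (DecidableEquality; tri<; tri≈; tri>)
open import Relation.Binary.PropositionalEquality
open import Relation.Nullary using (¬_; Dec; yes; no; contradiction)
open import Relation.Nullary.Decidable using (map′; toWitness; fromWitness; ⌊_⌋)

module Periodic (Δ : ℕ) .{{_ : NonZero Δ}} where

  congruent-apart : ∀ {m n} → m % Δ ≡ n % Δ → n < m → n + Δ ≤ m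
  congruent-apart {m} {n} m≡n n<m = begin
    n + Δ                       ≡⟨ cong (_+ Δ) (m≡m%n+[m/n]*n n Δ) ⟩
    n % Δ + (n / Δ) * Δ + Δ     ≡⟨ +-assoc (n % Δ) _ Δ ⟩
    n % Δ + ((n / Δ) * Δ + Δ)   ≡⟨ cong (n % Δ +_) (+-comm _ Δ) ⟩
    n % Δ + suc (n / Δ) * Δ     ≤⟨ +-monoʳ-≤ (n % Δ) (*-monoˡ-≤ Δ quotient-<) ⟩
    n % Δ + (m / Δ) * Δ         ≡⟨ cong (_+ (m / Δ) * Δ) m≡n ⟨
    m % Δ + (m / Δ) * Δ         ≡⟨ m≡m%n+[m/n]*n m Δ ⟨
    m                           ∎
    where
    open ≤-Reasoning
    quotient-< : n / Δ < m / Δ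
    quotient-< = *-cancelʳ-< Δ (n / Δ) (m / Δ) (+-cancelˡ-< (n % Δ) _ _
      (subst₂ _<_ (m≡m%n+[m/n]*n n Δ)
        (trans (m≡m%n+[m/n]*n m Δ) (cong (_+ (m / Δ) * Δ) m≡n)) n<m))

  infix 4 _⟶[_]_
  _⟶[_]_ : Fin Δ → ℕ → Fin Δ → Set
  p ⟶[ n ] q = (toℕ p + n) % Δ ≡ toℕ q

  toℕ-% : (p : Fin Δ) → toℕ p % Δ ≡ toℕ p
  toℕ-% p = m<n⇒m%n≡m (toℕ<n p)

  %-step : ∀ a b c → a % Δ ≡ b % Δ → (a + c) % Δ ≡ (b + c) % Δ
  %-step a b c eq = begin
    (a + c) % Δ             ≡⟨ %-distribˡ-+ a c Δ ⟩
    (a % Δ + c % Δ) % Δ     ≡⟨ cong (λ r → (r + c % Δ) % Δ) eq ⟩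
    (b % Δ + c % Δ) % Δ     ≡⟨ %-distribˡ-+ b c Δ ⟨
    (b + c) % Δ             ∎
    where open ≡-Reasoning

  ⟶-trans : ∀ p q r {m n} → p ⟶[ m ] q → q ⟶[ n ] r → p ⟶[ m + n ] r
  ⟶-trans p q r {m} {n} pq qr = begin
    (toℕ p + (m + n)) % Δ   ≡⟨ cong (_% Δ) (+-assoc (toℕ p) m n) ⟨
    (toℕ p + m + n) % Δ     ≡⟨ %-step (toℕ p + m) (toℕ q) n (trans pq (sym (toℕ-% q))) ⟩
    (toℕ q + n) % Δ         ≡⟨ qr ⟩
    toℕ r                   ∎
    where open ≡-Reasoning

  ⟶-functional : ∀ p {q r n} → p ⟶[ n ] q → p ⟶[ n ] r → q ≡ r
  ⟶-functional p pq pr = toℕ-injective (trans (sym pq) pr)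

  wait : Fin Δ → Fin Δ → ℕ
  wait p q = suc ((toℕ q + (Δ ∸ suc (toℕ p))) % Δ)

  wait-≤ : ∀ p q → wait p q ≤ Δ
  wait-≤ p q = m%n<n (toℕ q + (Δ ∸ suc (toℕ p))) Δ

  wait-⟶ : ∀ p q → p ⟶[ wait p q ] q
  wait-⟶ p q = begin
    (toℕ p + suc (x % Δ)) % Δ       ≡⟨ cong (_% Δ) (trans (+-suc (toℕ p) _) (+-comm (suc (toℕ p)) _)) ⟩
    (x % Δ + suc (toℕ p)) % Δ       ≡⟨ %-step (x % Δ) x (suc (toℕ p)) (m%n%n≡m%n x Δ) ⟩
    (x + suc (toℕ p)) % Δ           ≡⟨ cong (_% Δ) (+-assoc (toℕ q) _ _) ⟩
    (toℕ q + (Δ ∸ suc (toℕ p) + suc (toℕ p))) % Δ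
                                    ≡⟨ cong (λ d → (toℕ q + d) % Δ) (m∸n+n≡m (toℕ<n p)) ⟩
    (toℕ q + Δ) % Δ                 ≡⟨ [m+n]%n≡m%n (toℕ q) Δ ⟩
    toℕ q % Δ                       ≡⟨ toℕ-% q ⟩
    toℕ q                           ∎
    where
    open ≡-Reasoning
    x : ℕ
    x = toℕ q + (Δ ∸ suc (toℕ p))

  wait-% : ∀ {t p} q → t % Δ ≡ toℕ p → (t + wait p q) % Δ ≡ toℕ q
  wait-% {t} {p} q t≡p = trans (%-step t (toℕ p) (wait p q) (trans t≡p (sym (toℕ-% p)))) (wait-⟶ p q)

  wait-least : ∀ {t t′ p q} → t % Δ ≡ toℕ p → t′ % Δ ≡ toℕ q → t < t′ → t + wait p q ≤ t′
  wait-least {t} {t′} {p} {q} t≡p t′≡q t<t′ = ≮⇒≥ λ t′<t+w →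
    <⇒≱ t<t′ (+-cancelʳ-≤ Δ t′ t (≤-trans
      (congruent-apart (trans (wait-% q t≡p) (sym t′≡q)) t′<t+w)
      (+-monoʳ-≤ t (wait-≤ p q))))

  wait-unique : ∀ p q {n} → 1 ≤ n → n ≤ Δ → p ⟶[ n ] q → wait p q ≡ n
  wait-unique p q {n} 1≤n n≤Δ p⟶q = ≤-antisym w≤n (≮⇒≥ λ w<n → contradiction
    (≤-trans (congruent-apart (trans p⟶q (sym (wait-⟶ p q))) (+-monoʳ-< (toℕ p) w<n))
      (+-monoʳ-≤ (toℕ p) n≤Δ))
    (<⇒≱ (+-monoˡ-< Δ (m<m+n (toℕ p) z<s))))
    where
    w≤n : wait p q ≤ n
    w≤n = +-cancelˡ-≤ (toℕ p) _ _ (wait-least (toℕ-% p) p⟶q (m<m+n (toℕ p) 1≤n))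

  waits : List (Fin Δ) → ℕ
  waits []           = 0
  waits (p ∷ [])     = 0
  waits (p ∷ q ∷ xs) = wait p q + waits (q ∷ xs)

  waits-split : ∀ xs y ys → waits (xs ++ y ∷ ys) ≡ waits (xs ++ y ∷ []) + waits (y ∷ ys)
  waits-split []            y ys = refl
  waits-split (x ∷ [])      y ys = cong (_+ waits (y ∷ ys)) (sym (+-identityʳ (wait x y)))
  waits-split (x ∷ x′ ∷ xs) y ys = trans
    (cong (wait x x′ +_) (waits-split (x′ ∷ xs) y ys)) (sym (+-assoc (wait x x′) _ _))

  length-≤-waits-∷ʳ : ∀ xs y → length xs ≤ waits (xs ++ y ∷ [])
  length-≤-waits-∷ʳ []            y = z≤n
  length-≤-waits-∷ʳ (x ∷ [])      y = s≤s z≤n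
  length-≤-waits-∷ʳ (x ∷ x′ ∷ xs) y = +-mono-≤ {1} (s≤s z≤n) (length-≤-waits-∷ʳ (x′ ∷ xs) y)

  waits-⟶ : ∀ p xs q → p ⟶[ waits (p ∷ xs ++ q ∷ []) ] q
  waits-⟶ p []       q = subst (p ⟶[_] q) (sym (+-identityʳ (wait p q))) (wait-⟶ p q)
  waits-⟶ p (x ∷ xs) q = ⟶-trans p x q (wait-⟶ p x) (waits-⟶ x xs q)

  shift : ℕ → Fin Δ → Fin Δ
  shift n p = (toℕ p + n) mod Δ

  toℕ-mod : ∀ n → toℕ (n mod Δ) ≡ n % Δ
  toℕ-mod n = Fin.toℕ-fromℕ< (m%n<n n Δ)

  shift-⟶ : ∀ n p → p ⟶[ n ] shift n p
  shift-⟶ n p = sym (toℕ-mod (toℕ p + n))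

  wait-shift : ∀ n p q → wait (shift n p) (shift n q) ≡ wait p q
  wait-shift n p q = wait-unique (shift n p) (shift n q) (s≤s z≤n) (wait-≤ p q) (begin
    (toℕ (shift n p) + w) % Δ    ≡⟨ %-step (toℕ (shift n p)) (toℕ p + n) w
                                      (trans (cong (_% Δ) (toℕ-mod (toℕ p + n))) (m%n%n≡m%n (toℕ p + n) Δ)) ⟩
    (toℕ p + n + w) % Δ          ≡⟨ cong (_% Δ) (xy∙z≈xz∙y (toℕ p) n w) ⟩
    (toℕ p + w + n) % Δ          ≡⟨ %-step (toℕ p + w) (toℕ q) n (trans (wait-⟶ p q) (sym (toℕ-% q))) ⟩
    (toℕ q + n) % Δ              ≡⟨ toℕ-mod (toℕ q + n) ⟨
    toℕ (shift n q)              ∎)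
    where
    open ≡-Reasoning
    w : ℕ
    w = wait p q

  waits-shift : ∀ n xs → waits (map (shift n) xs) ≡ waits xs
  waits-shift n []           = refl
  waits-shift n (p ∷ [])     = refl
  waits-shift n (p ∷ q ∷ xs) = cong₂ _+_ (wait-shift n p q) (waits-shift n (q ∷ xs))

  ⟶-cancelˡ : ∀ p q r {m n} → p ⟶[ m ] q → p ⟶[ m + n ] r → q ⟶[ n ] r
  ⟶-cancelˡ p q r {m} {n} pq pr = begin
    (toℕ q + n) % Δ         ≡⟨ %-step (toℕ q) (toℕ p + m) n (trans (toℕ-% q) (sym pq)) ⟩
    (toℕ p + m + n) % Δ     ≡⟨ cong (_% Δ) (+-assoc (toℕ p) m n) ⟩
    (toℕ p + (m + n)) % Δ   ≡⟨ pr ⟩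
    toℕ r                   ∎
    where open ≡-Reasoning

  Δ-≤ : ∀ {n} (p q : Fin Δ) → (toℕ q + n) % Δ ≡ (toℕ p + n) % Δ → toℕ p < toℕ q → Δ ≤ toℕ q
  Δ-≤ {n} p q eq p<q = +-cancelʳ-≤ n Δ (toℕ q) (≤-trans (≤-reflexive (+-comm Δ n))
    (≤-trans (+-monoˡ-≤ Δ (m≤n+m n (toℕ p))) (congruent-apart eq (+-monoˡ-< n p<q))))

  ⟶-injective : ∀ p q r {n} → p ⟶[ n ] r → q ⟶[ n ] r → p ≡ q
  ⟶-injective p q r {n} pr qr with <-cmp (toℕ p) (toℕ q)
  ... | tri≈ _ p≡q _ = toℕ-injective p≡q
  ... | tri< p<q _ _ = contradiction (toℕ<n q) (≤⇒≯ (Δ-≤ p q (trans qr (sym pr)) p<q))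
  ... | tri> _ _ q<p = contradiction (toℕ<n p) (≤⇒≯ (Δ-≤ q p (trans pr (sym qr)) q<p))

  mod-⟶ : ∀ m n → m mod Δ ⟶[ n ] (m + n) mod Δ
  mod-⟶ m n = begin
    (toℕ (m mod Δ) + n) % Δ     ≡⟨ %-step (toℕ (m mod Δ)) m n (trans (cong (_% Δ) (toℕ-mod m)) (m%n%n≡m%n m Δ)) ⟩
    (m + n) % Δ                 ≡⟨ toℕ-mod (m + n) ⟨
    toℕ ((m + n) mod Δ)         ∎
    where open ≡-Reasoning

  waits-++-≥ : ∀ x xs y ys → waits (x ∷ xs) + suc (waits (y ∷ ys)) ≤ waits (x ∷ xs ++ y ∷ ys)
  waits-++-≥ x []        y ys = s≤s (m≤n+m _ _)
  waits-++-≥ x (x′ ∷ xs) y ys = ≤-trans (≤-reflexive (+-assoc (wait x x′) _ _))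
    (+-monoʳ-≤ (wait x x′) (waits-++-≥ x′ xs y ys))

data Simple (G : Digraph) : Digraph.V G → Digraph.V G → List (Digraph.V G) → Set where
  stop : ∀ {u} → Simple G u u (u ∷ [])
  step : ∀ {u v z xs} → Digraph.Edge G u v → u ∉ xs → Simple G v z xs → Simple G u z (u ∷ xs)

module _ {G : Digraph} where
  open Digraph G

  source-∈ : ∀ {u z xs} → Simple G u z xs → u ∈ xs
  source-∈ stop         = here refl
  source-∈ (step _ _ _) = here refl

  simple-++ : ∀ {u v w z xs ys} → Simple G u v xs → Edge v w → Simple G w z ys →
              (∀ {a} → a ∈ xs → a ∉ ys) → Simple G u z (xs ++ ys)
  simple-++ stop            v→w q disjoint = step v→w (disjoint (here refl)) q
  simple-++ {ys = ys} (step {xs = xs} e u∉ p) v→w q disjoint =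
    step e u∉′ (simple-++ p v→w q (disjoint ∘ there))
    where
    u∉′ : _ ∉ xs ++ ys
    u∉′ u∈ with ∈-++⁻ xs u∈
    ... | inj₁ u∈xs = u∉ u∈xs
    ... | inj₂ u∈ys = disjoint (here refl) u∈ys

  path⇒simple : ∀ ℓ (f : Fin (suc ℓ) → V) → (∀ {i j} → f i ≡ f j → i ≡ j) →
                (∀ i → Edge (f (inject₁ i)) (f (suc i))) →
                Simple G (f zero) (f (fromℕ ℓ)) (tabulate f)
  path⇒simple zero    f f-inj edges = stop
  path⇒simple (suc ℓ) f f-inj edges = step (edges zero) f0∉
    (path⇒simple ℓ (f ∘ suc) (Fin.suc-injective ∘ f-inj) (edges ∘ suc))
    where
    f0∉ : f zero ∉ tabulate (f ∘ suc)
    f0∉ f0∈ with ∈-tabulate⁻ f0∈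
    ... | i , eq with f-inj {zero} {suc i} eq
    ... | ()

  simplePath : ∀ {ℓ u z} (P : Path G ℓ u z) → Simple G u z (tabulate (Path.vertex P))
  simplePath {ℓ} P = subst₂ (λ u z → Simple G u z (tabulate vertex)) source target
    (path⇒simple ℓ vertex distinct edges)
    where open Path P

  simple⇒path : ∀ {u z xs} → Simple G u z xs →
                ∃[ ℓ ] ∃[ P ] tabulate (Path.vertex {G} {ℓ} {u} {z} P) ≡ xs
  simple⇒path {u} stop = 0 , record
    { vertex = λ _ → u ; source = refl ; target = refl
    ; distinct = λ { {zero} {zero} _ → refl } ; edges = λ () } , refl
  simple⇒path {u} (step u→v u∉ p) with simple⇒path p
  ... | ℓ , P , refl = suc ℓ , record
    { vertex   = vertex′
    ; source   = refl
    ; target   = Path.target P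
    ; distinct = distinct′
    ; edges    = λ { zero → subst (Edge u) (sym (Path.source P)) u→v ; (suc i) → Path.edges P i }
    } , refl
    where
    vertex′ : Fin (suc (suc ℓ)) → V
    vertex′ zero    = u
    vertex′ (suc i) = Path.vertex P i
    distinct′ : ∀ {i j} → vertex′ i ≡ vertex′ j → i ≡ j
    distinct′ {zero}  {zero}  eq = refl
    distinct′ {zero}  {suc j} eq = contradiction (subst (_∈ _) (sym eq) (∈-tabulate⁺ {f = Path.vertex P} j)) u∉
    distinct′ {suc i} {zero}  eq = contradiction (subst (_∈ _) eq (∈-tabulate⁺ {f = Path.vertex P} i)) u∉
    distinct′ {suc i} {suc j} eq = cong suc (Path.distinct P eq)

-- Two disjoint induced subgraphs joined by the single edge between x and y.
module Bridge {G H K : Digraph} (i : Digraph.V H → Digraph.V G) (j : Digraph.V K → Digraph.V G)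
  (x : Digraph.V H) (y : Digraph.V K)
  (i-injective : ∀ {a b} → i a ≡ i b → a ≡ b)
  (apart : ∀ {a b} → i a ≢ j b)
  (cover : ∀ w → (∃[ a ] w ≡ i a) ⊎ (∃[ b ] w ≡ j b))
  (within : ∀ {a b} → Digraph.Edge G (i a) (i b) → Digraph.Edge H a b)
  (leave : ∀ {a b} → Digraph.Edge G (i a) (j b) → a ≡ x × b ≡ y)
  (return : ∀ {a b} → Digraph.Edge G (j b) (i a) → a ≡ x × b ≡ y)
  where

  return-visits : ∀ {b a xs} → Simple G (j b) (i a) xs → i x ∈ xs
  return-visits p = go p refl refl
    where
    go : ∀ {u z b a xs} → Simple G u z xs → u ≡ j b → z ≡ i a → i x ∈ xs
    go stop u≡ z≡ = ⊥-elim (apart (trans (sym z≡) u≡))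
    go (step {v = v} e u∉ p) refl z≡ with cover v
    ... | inj₂ (b′ , refl) = there (go p refl z≡)
    ... | inj₁ (a′ , refl) with return e
    ... | refl , refl = there (source-∈ p)

  stay : ∀ {a b xs} → Simple G (i a) (i b) xs → ∃[ ys ] (xs ≡ map i ys × Simple H a b ys)
  stay p = go p refl refl
    where
    go : ∀ {u z a b xs} → Simple G u z xs → u ≡ i a → z ≡ i b →
         ∃[ ys ] (xs ≡ map i ys × Simple H a b ys)
    go {a = a} stop refl z≡ with i-injective z≡
    ... | refl = a ∷ [] , refl , stop
    go {a = a} (step {v = v} e u∉ p) refl refl with cover v
    ... | inj₁ (a′ , refl) with go p refl refl
    ...   | ys , refl , q = a ∷ ys , refl , step (within e) (u∉ ∘ ∈-map⁺ i) q
    go {a = a} (step {v = v} e u∉ p) refl refl | inj₂ (b′ , refl) with leave e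
    ...   | refl , refl = contradiction (return-visits p) u∉

  cross : (∀ {a b xs} → Simple G (j a) (j b) xs → ∃[ ys ] (xs ≡ map j ys × Simple K a b ys)) →
          ∀ {a b xs} → Simple G (i a) (j b) xs →
          ∃[ ys ] ∃[ zs ] (xs ≡ map i ys ++ map j zs × Simple H a x ys × Simple K y b zs)
  cross stay′ p = go p refl refl
    where
    go : ∀ {u z a b xs} → Simple G u z xs → u ≡ i a → z ≡ j b →
         ∃[ ys ] ∃[ zs ] (xs ≡ map i ys ++ map j zs × Simple H a x ys × Simple K y b zs)
    go stop u≡ z≡ = ⊥-elim (apart (trans (sym u≡) z≡))
    go {a = a} (step {v = v} e u∉ p) refl refl with cover v
    ... | inj₁ (a′ , refl) with go p refl refl
    ...   | ys , zs , refl , q , r =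
      a ∷ ys , zs , refl , step (within e) (u∉ ∘ ∈-++⁺ˡ ∘ ∈-map⁺ i) q , r
    go {a = a} (step {v = v} e u∉ p) refl refl | inj₂ (b′ , refl) with leave e
    ...   | refl , refl with stay′ p
    ...     | zs , refl , r = a ∷ [] , zs , refl , stop , r

-- The vertex sets are sums, so the trees and their vertices are defined simultaneously.
data Tree : Set
Vertex : Tree → Set

data Tree where
  single : Tree
  join   : (s : Tree) → Vertex s → (t : Tree) → Vertex t → Tree

Vertex single         = ⊤
Vertex (join s _ t _) = Vertex s ⊎ Vertex t

vertex-≟ : ∀ t → DecidableEquality (Vertex t)
vertex-≟ single         = Unit._≟_
vertex-≟ (join s _ t _) = ≡-dec (vertex-≟ s) (vertex-≟ t)

adjacent : ∀ t → Vertex t → Vertex t → Bool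
adjacent single         _        _        = false
adjacent (join s x t y) (inj₁ a) (inj₁ b) = adjacent s a b
adjacent (join s x t y) (inj₂ a) (inj₂ b) = adjacent t a b
adjacent (join s x t y) (inj₁ a) (inj₂ b) = ⌊ vertex-≟ s a x ⌋ ∧ ⌊ vertex-≟ t b y ⌋
adjacent (join s x t y) (inj₂ b) (inj₁ a) = ⌊ vertex-≟ s a x ⌋ ∧ ⌊ vertex-≟ t b y ⌋

graph : Tree → Graph
graph t = record
  { V = Vertex t ; finite = vertex-finite t ; adj = adjacent t
  ; symm = adjacent-sym t ; irrefl = adjacent-irrefl t }
  where
  vertex-finite : ∀ t → ∃[ n ] (Vertex t ↔ Fin n)
  vertex-finite single = 1 , ↔-sym 1↔⊤
  vertex-finite (join s _ t _) with vertex-finite s | vertex-finite t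
  ... | m , V↔m | n , V↔n = m + n , ↔-sym +↔⊎ ↔-∘ (V↔m ⊎-↔ V↔n)

  adjacent-sym : ∀ t u v → adjacent t u v ≡ adjacent t v u
  adjacent-sym single         _        _        = refl
  adjacent-sym (join s x t y) (inj₁ a) (inj₁ b) = adjacent-sym s a b
  adjacent-sym (join s x t y) (inj₁ a) (inj₂ b) = refl
  adjacent-sym (join s x t y) (inj₂ a) (inj₁ b) = refl
  adjacent-sym (join s x t y) (inj₂ a) (inj₂ b) = adjacent-sym t a b

  adjacent-irrefl : ∀ t v → adjacent t v v ≡ false
  adjacent-irrefl single         _        = refl
  adjacent-irrefl (join s x t y) (inj₁ a) = adjacent-irrefl s a
  adjacent-irrefl (join s x t y) (inj₂ b) = adjacent-irrefl t b

digraph : Tree → Digraph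
digraph t = Graph.bidirected (graph t)

route : ∀ t → Vertex t → Vertex t → List (Vertex t)
route single         _        _        = tt ∷ []
route (join s x t y) (inj₁ a) (inj₁ b) = map inj₁ (route s a b)
route (join s x t y) (inj₂ a) (inj₂ b) = map inj₂ (route t a b)
route (join s x t y) (inj₁ a) (inj₂ b) = map inj₁ (route s a x) ++ map inj₂ (route t y b)
route (join s x t y) (inj₂ b) (inj₁ a) = map inj₂ (route t b y) ++ map inj₁ (route s x a)

module _ (s : Tree) (x : Vertex s) (t : Tree) (y : Vertex t) where

  private
    st : Tree
    st = join s x t y

  bridge⁺ : T (adjacent st (inj₁ x) (inj₂ y))
  bridge⁺ = Equivalence.from (T-∧ {⌊ vertex-≟ s x x ⌋})
    (fromWitness {a? = vertex-≟ s x x} refl , fromWitness {a? = vertex-≟ t y y} refl)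

  bridge⁻ : ∀ {a b} → T (adjacent st (inj₁ a) (inj₂ b)) → a ≡ x × b ≡ y
  bridge⁻ {a} {b} e with Equivalence.to (T-∧ {⌊ vertex-≟ s a x ⌋}) e
  ... | a≡x , b≡y = toWitness {a? = vertex-≟ s a x} a≡x , toWitness {a? = vertex-≟ t b y} b≡y

  simple-inj₁ : ∀ {a b xs} → Simple (digraph s) a b xs →
                Simple (digraph st) (inj₁ a) (inj₁ b) (map inj₁ xs)
  simple-inj₁ stop          = stop
  simple-inj₁ (step e u∉ p) = step e (u∉ ∘ ∈-map-inj) (simple-inj₁ p)
    where
    ∈-map-inj : ∀ {a xs} → inj₁ a ∈ map inj₁ xs → a ∈ xs
    ∈-map-inj a∈ with ∈-map⁻ inj₁ a∈
    ... | _ , b∈ , refl = b∈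

  simple-inj₂ : ∀ {a b xs} → Simple (digraph t) a b xs →
                Simple (digraph st) (inj₂ a) (inj₂ b) (map inj₂ xs)
  simple-inj₂ stop          = stop
  simple-inj₂ (step e u∉ p) = step e (u∉ ∘ ∈-map-inj) (simple-inj₂ p)
    where
    ∈-map-inj : ∀ {a xs} → inj₂ a ∈ map inj₂ xs → a ∈ xs
    ∈-map-inj a∈ with ∈-map⁻ inj₂ a∈
    ... | _ , b∈ , refl = b∈

  inj₁-inj₂-disjoint : ∀ {xs ys} {c : Vertex st} → c ∈ map inj₁ xs → c ∉ map inj₂ ys
  inj₁-inj₂-disjoint c∈₁ c∈₂ with ∈-map⁻ inj₁ c∈₁ | ∈-map⁻ inj₂ c∈₂
  ... | _ , _ , refl | _ , _ , ()

  embed₁ : Vertex s → Vertex st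
  embed₁ = inj₁

  embed₂ : Vertex t → Vertex st
  embed₂ = inj₂

  embed₁-injective : ∀ {a b} → embed₁ a ≡ embed₁ b → a ≡ b
  embed₁-injective = inj₁-injective

  embed₂-injective : ∀ {a b} → embed₂ a ≡ embed₂ b → a ≡ b
  embed₂-injective = inj₂-injective

  embed₁≢embed₂ : ∀ {a b} → embed₁ a ≢ embed₂ b
  embed₁≢embed₂ ()

  cover₁ : ∀ w → (∃[ a ] w ≡ embed₁ a) ⊎ (∃[ b ] w ≡ embed₂ b)
  cover₁ (inj₁ a) = inj₁ (a , refl)
  cover₁ (inj₂ b) = inj₂ (b , refl)

  cover₂ : ∀ w → (∃[ b ] w ≡ embed₂ b) ⊎ (∃[ a ] w ≡ embed₁ a)
  cover₂ (inj₁ a) = inj₂ (a , refl)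
  cover₂ (inj₂ b) = inj₁ (b , refl)

  module Left = Bridge {digraph st} {digraph s} {digraph t} embed₁ embed₂ x y
    embed₁-injective embed₁≢embed₂ cover₁ id bridge⁻ bridge⁻

  module Right = Bridge {digraph st} {digraph t} {digraph s} embed₂ embed₁ y x
    embed₂-injective (embed₁≢embed₂ ∘ sym) cover₂ id (swap ∘ bridge⁻) (swap ∘ bridge⁻)

route-simple : ∀ t u v → Simple (digraph t) u v (route t u v)
route-simple single         _        _        = stop
route-simple (join s x t y) (inj₁ a) (inj₁ b) = simple-inj₁ s x t y (route-simple s a b)
route-simple (join s x t y) (inj₂ a) (inj₂ b) = simple-inj₂ s x t y (route-simple t a b)
route-simple (join s x t y) (inj₁ a) (inj₂ b) = simple-++
  (simple-inj₁ s x t y (route-simple s a x)) (bridge⁺ s x t y)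
  (simple-inj₂ s x t y (route-simple t y b)) (inj₁-inj₂-disjoint s x t y)
route-simple (join s x t y) (inj₂ b) (inj₁ a) = simple-++
  (simple-inj₂ s x t y (route-simple t b y)) (bridge⁺ s x t y)
  (simple-inj₁ s x t y (route-simple s x a))
  (λ c∈₂ c∈₁ → inj₁-inj₂-disjoint s x t y c∈₁ c∈₂)

route-unique : ∀ t {u v xs} → Simple (digraph t) u v xs → xs ≡ route t u v
route-unique single stop = refl
route-unique (join s x t y) {inj₁ a} {inj₁ b} p with Left.stay s x t y p
... | _ , refl , q = cong (map inj₁) (route-unique s q)
route-unique (join s x t y) {inj₂ a} {inj₂ b} p with Right.stay s x t y p
... | _ , refl , q = cong (map inj₂) (route-unique t q)
route-unique (join s x t y) {inj₁ a} {inj₂ b} p with Left.cross s x t y (Right.stay s x t y) p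
... | _ , _ , refl , q , r =
  cong₂ (λ ys zs → map inj₁ ys ++ map inj₂ zs) (route-unique s q) (route-unique t r)
route-unique (join s x t y) {inj₂ b} {inj₁ a} p with Right.cross s x t y (Left.stay s x t y) p
... | _ , _ , refl , q , r =
  cong₂ (λ ys zs → map inj₂ ys ++ map inj₁ zs) (route-unique t q) (route-unique s r)

isTree : ∀ t → IsTree (graph t)
isTree t = record
  { connected = λ u v → let ℓ , P , _ = simple⇒path (route-simple t u v) in ℓ , P
  ; acyclic   = acyclic
  }
  where
  acyclic : ∀ {ℓ u v} → Path (digraph t) (suc (suc ℓ)) u v → ¬ T (adjacent t v u)
  acyclic {ℓ} {u} {v} P v→u = contradiction
    (trans (route-unique t (simplePath P)) (sym (route-unique t u→v))) λ ()
    where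
    u≢v : u ≢ v
    u≢v refl = subst T (Graph.irrefl (graph t) u) v→u
    u→v : Simple (digraph t) u v (u ∷ v ∷ [])
    u→v = step (subst T (Graph.symm (graph t) v u) v→u) (λ { (here u≡v) → u≢v u≡v }) stop

module _ {V A : Set} where

  labels : (V → V → A) → List V → List A
  labels l []           = []
  labels l (u ∷ [])     = []
  labels l (u ∷ v ∷ xs) = l u v ∷ labels l (v ∷ xs)

  labels-tabulate : ∀ l {ℓ} (f : Fin (suc ℓ) → V) →
    labels l (tabulate f) ≡ tabulate (λ i → l (f (inject₁ i)) (f (suc i)))
  labels-tabulate l {zero}  f = refl
  labels-tabulate l {suc ℓ} f = cong (l _ _ ∷_) (labels-tabulate l (f ∘ suc))

labels-map : ∀ {V W A : Set} (l : V → V → A) (f : W → V) xs → labels l (map f xs) ≡ labels (l on f) xs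
labels-map l f []           = refl
labels-map l f (u ∷ [])     = refl
labels-map l f (u ∷ v ∷ xs) = cong (l (f u) (f v) ∷_) (labels-map l f (v ∷ xs))

labels-++ : ∀ {G : Digraph} {A : Set} (l : Digraph.V G → Digraph.V G → A) {u v w z xs ys} →
  Simple G u v xs → Simple G w z ys → labels l (xs ++ ys) ≡ labels l xs ++ l v w ∷ labels l ys
labels-++ l stop stop         = refl
labels-++ l stop (step _ _ _) = refl
labels-++ l (step _ _ stop)           q = cong (_ ∷_) (labels-++ l stop q)
labels-++ l (step _ _ p@(step _ _ _)) q = cong (_ ∷_) (labels-++ l p q)

routeLabels : ∀ {A : Set} t → (Vertex t → Vertex t → A) → Vertex t → Vertex t → List A
routeLabels single         l _        _        = []
routeLabels (join s x t y) l (inj₁ a) (inj₁ b) = routeLabels s (l on inj₁) a b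
routeLabels (join s x t y) l (inj₂ a) (inj₂ b) = routeLabels t (l on inj₂) a b
routeLabels (join s x t y) l (inj₁ a) (inj₂ b) =
  routeLabels s (l on inj₁) a x ++ l (inj₁ x) (inj₂ y) ∷ routeLabels t (l on inj₂) y b
routeLabels (join s x t y) l (inj₂ b) (inj₁ a) =
  routeLabels t (l on inj₂) b y ++ l (inj₂ y) (inj₁ x) ∷ routeLabels s (l on inj₁) x a

labels-route : ∀ {A : Set} t (l : Vertex t → Vertex t → A) u v →
               labels l (route t u v) ≡ routeLabels t l u v
labels-route single l _ _ = refl
labels-route (join s x t y) l (inj₁ a) (inj₁ b) =
  trans (labels-map l inj₁ (route s a b)) (labels-route s (l on inj₁) a b)
labels-route (join s x t y) l (inj₂ a) (inj₂ b) =
  trans (labels-map l inj₂ (route t a b)) (labels-route t (l on inj₂) a b)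
labels-route (join s x t y) l (inj₁ a) (inj₂ b) = trans
  (labels-++ l (simple-inj₁ s x t y (route-simple s a x)) (simple-inj₂ s x t y (route-simple t y b)))
  (cong₂ (λ ps qs → ps ++ l (inj₁ x) (inj₂ y) ∷ qs)
    (trans (labels-map l inj₁ (route s a x)) (labels-route s (l on inj₁) a x))
    (trans (labels-map l inj₂ (route t y b)) (labels-route t (l on inj₂) y b)))
labels-route (join s x t y) l (inj₂ b) (inj₁ a) = trans
  (labels-++ l (simple-inj₂ s x t y (route-simple t b y)) (simple-inj₁ s x t y (route-simple s x a)))
  (cong₂ (λ ps qs → ps ++ l (inj₂ y) (inj₁ x) ∷ qs)
    (trans (labels-map l inj₂ (route t b y)) (labels-route t (l on inj₂) b y))
    (trans (labels-map l inj₁ (route s x a)) (labels-route s (l on inj₁) x a)))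

routeLabels-refl : ∀ {A : Set} t (l : Vertex t → Vertex t → A) u → routeLabels t l u u ≡ []
routeLabels-refl single         l _        = refl
routeLabels-refl (join s x t y) l (inj₁ a) = routeLabels-refl s (l on inj₁) a
routeLabels-refl (join s x t y) l (inj₂ b) = routeLabels-refl t (l on inj₂) b

path-labels : ∀ {A : Set} t (l : Vertex t → Vertex t → A) {ℓ u v} (P : Path (digraph t) ℓ u v) →
  tabulate (λ i → l (Path.vertex P (inject₁ i)) (Path.vertex P (suc i))) ≡ routeLabels t l u v
path-labels t l {u = u} {v} P = begin
  tabulate _                       ≡⟨ labels-tabulate l (Path.vertex P) ⟨
  labels l (tabulate (Path.vertex P)) ≡⟨ cong (labels l) (route-unique t (simplePath P)) ⟩
  labels l (route t u v)           ≡⟨ labels-route t l u v ⟩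
  routeLabels t l u v              ∎
  where open ≡-Reasoning

distance : ∀ {A : Set} t (l : Vertex t → Vertex t → A) u v →
           IsDistance (digraph t) u v (length (routeLabels t l u v))
distance t l u v = subst (λ ℓ → Path (digraph t) ℓ u v) (path-length P) P ,
  λ Q → ≤-reflexive (sym (path-length Q))
  where
  P : Path (digraph t) _ u v
  P = proj₁ (proj₂ (simple⇒path (route-simple t u v)))
  path-length : ∀ {ℓ} → Path (digraph t) ℓ u v → ℓ ≡ length (routeLabels t l u v)
  path-length Q = trans (sym (length-tabulate _)) (cong length (path-labels t l Q))

module Temporal (Δ : ℕ) .{{_ : NonZero Δ}} where
  open Periodic Δ

  waits-lower : ∀ {ℓ} (p : Fin (suc ℓ) → Fin Δ) (time : Fin (suc ℓ) → ℕ) →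
    (∀ i → time i % Δ ≡ toℕ (p i)) → (∀ {i j} → i Fin.< j → time i < time j) →
    time zero + waits (tabulate p) ≤ time (fromℕ ℓ)
  waits-lower {zero}  p time active increasing = ≤-reflexive (+-identityʳ (time zero))
  waits-lower {suc ℓ} p time active increasing = begin
    time zero + (wait (p zero) (p (suc zero)) + waits (tabulate (p ∘ suc)))
      ≡⟨ +-assoc (time zero) _ _ ⟨
    time zero + wait (p zero) (p (suc zero)) + waits (tabulate (p ∘ suc))
      ≤⟨ +-monoˡ-≤ _ (wait-least (active zero) (active (suc zero)) (increasing (s≤s z≤n))) ⟩
    time (suc zero) + waits (tabulate (p ∘ suc))
      ≤⟨ waits-lower (p ∘ suc) (time ∘ suc) (active ∘ suc) (increasing ∘ s≤s) ⟩
    time (fromℕ (suc ℓ)) ∎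
    where open ≤-Reasoning

  greedy : ∀ {ℓ} → ℕ → (Fin (suc ℓ) → Fin Δ) → Fin (suc ℓ) → ℕ
  greedy         t p zero    = t
  greedy {suc ℓ} t p (suc i) = greedy (t + wait (p zero) (p (suc zero))) (p ∘ suc) i

  greedy-active : ∀ {ℓ} t (p : Fin (suc ℓ) → Fin Δ) → t % Δ ≡ toℕ (p zero) →
                  ∀ i → greedy t p i % Δ ≡ toℕ (p i)
  greedy-active         t p t≡ zero    = t≡
  greedy-active {suc ℓ} t p t≡ (suc i) = greedy-active _ (p ∘ suc) (wait-% (p (suc zero)) t≡) i

  greedy-≥ : ∀ {ℓ} t (p : Fin (suc ℓ) → Fin Δ) i → t ≤ greedy t p i
  greedy-≥         t p zero    = ≤-refl
  greedy-≥ {suc ℓ} t p (suc i) = ≤-trans (m≤m+n t _) (greedy-≥ _ (p ∘ suc) i)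

  greedy-increasing : ∀ {ℓ} t (p : Fin (suc ℓ) → Fin Δ) {i j} → i Fin.< j → greedy t p i < greedy t p j
  greedy-increasing {suc ℓ} t p {zero}  {suc j} _         =
    ≤-trans (m<m+n t z<s) (greedy-≥ _ (p ∘ suc) j)
  greedy-increasing {suc ℓ} t p {suc i} {suc j} (s≤s i<j) = greedy-increasing _ (p ∘ suc) i<j

  greedy-last : ∀ {ℓ} t (p : Fin (suc ℓ) → Fin Δ) → greedy t p (fromℕ ℓ) ≡ t + waits (tabulate p)
  greedy-last {zero}  t p = sym (+-identityʳ t)
  greedy-last {suc ℓ} t p = trans (greedy-last _ (p ∘ suc)) (+-assoc t _ _)

  module _ (t : Tree) where

    private
      G : Digraph
      G = digraph t

    active⇒% : ∀ (lab : Labeling G Δ) {u v} (e : Digraph.Edge G u v) {τ} → Active G lab e τ → τ % Δ ≡ toℕ (lab u v e)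
    active⇒% lab {u} {v} e (i , refl) =
      trans ([m+kn]%n≡m%n (toℕ (lab u v e)) i Δ) (m<n⇒m%n≡m (toℕ<n (lab u v e)))

    %⇒active : ∀ (lab : Labeling G Δ) {u v} (e : Digraph.Edge G u v) {τ} → τ % Δ ≡ toℕ (lab u v e) → Active G lab e τ
    %⇒active lab e {τ} eq = τ / Δ , trans (m≡m%n+[m/n]*n τ Δ) (cong (_+ (τ / Δ) * Δ) eq)

    total : Labeling G Δ → Vertex t → Vertex t → Fin Δ
    total lab u v with T? (adjacent t u v)
    ... | yes e = lab u v e
    ... | no  _ = 0 mod Δ

    total-edge : ∀ lab {u v} (e : Digraph.Edge G u v) → total lab u v ≡ lab u v e
    total-edge lab {u} {v} e with T? (adjacent t u v)
    ... | yes e′ = cong (lab u v) (T-irrelevant e′ e)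
    ... | no ¬e  = contradiction e ¬e

    travel : Labeling G Δ → Vertex t → Vertex t → ℕ
    travel lab u v = suc (waits (routeLabels t (total lab) u v))

    module _ (lab : Labeling G Δ) {u v : Vertex t} where

      sequence : ∀ {ℓ} → Path G ℓ u v → Fin ℓ → Fin Δ
      sequence P i = lab _ _ (Path.edges P i)

      sequence-labels : ∀ {ℓ} (P : Path G ℓ u v) →
                        tabulate (sequence P) ≡ routeLabels t (total lab) u v
      sequence-labels P = trans
        (tabulate-cong λ i → sym (total-edge lab (Path.edges P i))) (path-labels t (total lab) P)

      travel-≤-duration : ∀ (Q : TemporalPath G lab u v) → travel lab u v ≤ duration Q
      travel-≤-duration Q = begin
        suc (waits (routeLabels t (total lab) u v))   ≡⟨ cong (suc ∘ waits) (sequence-labels path) ⟨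
        suc (waits (tabulate (sequence path)))        ≤⟨ m+n≤o⇒m≤o∸n _ bound ⟩
        time (fromℕ ℓ) + 1 ∸ time zero                ∎
        where
        open TemporalPath Q
        open ≤-Reasoning
        bound : suc (waits (tabulate (sequence path))) + time zero ≤ time (fromℕ ℓ) + 1
        bound = begin
          suc (waits (tabulate (sequence path))) + time zero
            ≡⟨ cong suc (+-comm _ (time zero)) ⟩
          suc (time zero + waits (tabulate (sequence path)))
            ≤⟨ s≤s (waits-lower (sequence path) time (λ i → active⇒% lab (Path.edges path i) (active i)) increasing) ⟩
          suc (time (fromℕ ℓ))
            ≡⟨ +-comm 1 _ ⟩
          time (fromℕ ℓ) + 1 ∎

      earliest : u ≢ v → Σ (TemporalPath G lab u v) λ Q → duration Q ≡ travel lab u v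
      earliest u≢v with simple⇒path (route-simple t u v)
      ... | zero  , P , _ = contradiction (trans (sym (Path.source P)) (Path.target P)) u≢v
      ... | suc ℓ , P , _ = Q , (begin
        greedy t₀ p (fromℕ ℓ) + 1 ∸ t₀                ≡⟨ cong (λ τ → τ + 1 ∸ t₀) (greedy-last t₀ p) ⟩
        t₀ + waits (tabulate p) + 1 ∸ t₀              ≡⟨ cong (_∸ t₀) (+-assoc t₀ _ 1) ⟩
        t₀ + (waits (tabulate p) + 1) ∸ t₀            ≡⟨ m+n∸m≡n t₀ _ ⟩
        waits (tabulate p) + 1                        ≡⟨ +-comm _ 1 ⟩
        suc (waits (tabulate p))                      ≡⟨ cong (suc ∘ waits) (sequence-labels P) ⟩
        travel lab u v                                ∎)
        where
        open ≡-Reasoning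
        p : Fin (suc ℓ) → Fin Δ
        p = sequence P
        t₀ : ℕ
        t₀ = toℕ (p zero)
        Q : TemporalPath G lab u v
        Q = record
          { path = P ; time = greedy t₀ p
          ; active = λ i → %⇒active lab (Path.edges P i) (greedy-active t₀ p (toℕ-% (p zero)) i)
          ; increasing = greedy-increasing t₀ p }

    routeLabels-total : ∀ (l : Vertex t → Vertex t → Fin Δ) u v →
                        routeLabels t (total λ a b _ → l a b) u v ≡ routeLabels t l u v
    routeLabels-total l u v =
      let _ , P , _ = simple⇒path (route-simple t u v)
      in trans (sym (sequence-labels (λ a b _ → l a b) P)) (path-labels t l P)

Searchable : Set → Set₁
Searchable A = ∀ {P : A → Set} → (∀ a → Dec (P a)) → Dec (∃ P)

search-× : ∀ {A B} → Searchable A → Searchable B → Searchable (A × B)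
search-× search-A search-B P? = map′ (λ (a , b , p) → (a , b) , p) (λ ((a , b) , p) → a , b , p)
  (search-A λ a → search-B λ b → P? (a , b))

argmin : ∀ {A} → Searchable A → (f : A → ℕ) → A → ∃[ a ] (∀ b → f a ≤ f b)
argmin search f a = go (f a) a ≤-refl
  where
  go : ∀ n a → f a ≤ n → ∃[ a′ ] (∀ b → f a′ ≤ f b)
  go n a fa≤n with search (λ b → f b <? f a)
  ... | no none = a , λ b → ≮⇒≥ λ fb<fa → none (b , fb<fa)
  go zero    a fa≤n | yes (b , fb<fa) = contradiction (≤-trans fb<fa fa≤n) λ ()
  go (suc n) a fa≤n | yes (b , fb<fa) = go n b (s≤s⁻¹ (≤-trans fb<fa fa≤n))

-- Functions on the vertices as data, which makes them searchable without extensionality.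
Table : Tree → Set → Set
Table single         A = A
Table (join s _ t _) A = Table s A × Table t A

lookup : ∀ {A} t → Table t A → Vertex t → A
lookup single         a       _        = a
lookup (join s _ t _) (f , _) (inj₁ u) = lookup s f u
lookup (join s _ t _) (_ , g) (inj₂ v) = lookup t g v

table : ∀ {A} t → (Vertex t → A) → Table t A
table single         f = f tt
table (join s _ t _) f = table s (f ∘ inj₁) , table t (f ∘ inj₂)

lookup-table : ∀ {A} t (f : Vertex t → A) u → lookup t (table t f) u ≡ f u
lookup-table single         f tt       = refl
lookup-table (join s _ t _) f (inj₁ u) = lookup-table s (f ∘ inj₁) u
lookup-table (join s _ t _) f (inj₂ v) = lookup-table t (f ∘ inj₂) v

search-Table : ∀ {A} t → Searchable A → Searchable (Table t A)
search-Table single         search = search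
search-Table (join s _ t _) search = search-× (search-Table s search) (search-Table t search)

∑ : ∀ t → (Vertex t → ℕ) → ℕ
∑ single         f = f tt
∑ (join s _ t _) f = ∑ s (f ∘ inj₁) + ∑ t (f ∘ inj₂)

∑-mono : ∀ t {f g} → (∀ u → f u ≤ g u) → ∑ t f ≤ ∑ t g
∑-mono single         f≤g = f≤g tt
∑-mono (join s _ t _) f≤g = +-mono-≤ (∑-mono s (f≤g ∘ inj₁)) (∑-mono t (f≤g ∘ inj₂))

+-reflects-≥ : ∀ {a b c d} → a ≤ c → b ≤ d → c + d ≤ a + b → c ≤ a × d ≤ b
+-reflects-≥ {a} {b} {c} {d} a≤c b≤d c+d≤a+b =
  +-cancelʳ-≤ d c a (≤-trans c+d≤a+b (+-monoʳ-≤ a b≤d)) ,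
  +-cancelˡ-≤ c d b (≤-trans c+d≤a+b (+-monoˡ-≤ b a≤c))

∑-reflects-≥ : ∀ t {f g} → (∀ u → f u ≤ g u) → ∑ t g ≤ ∑ t f → ∀ u → g u ≤ f u
∑-reflects-≥ single f≤g ∑g≤∑f tt = ∑g≤∑f
∑-reflects-≥ (join s _ t _) f≤g ∑g≤∑f (inj₁ u) = ∑-reflects-≥ s (f≤g ∘ inj₁)
  (proj₁ (+-reflects-≥ (∑-mono s (f≤g ∘ inj₁)) (∑-mono t (f≤g ∘ inj₂)) ∑g≤∑f)) u
∑-reflects-≥ (join s _ t _) f≤g ∑g≤∑f (inj₂ v) = ∑-reflects-≥ t (f≤g ∘ inj₂)
  (proj₂ (+-reflects-≥ (∑-mono s (f≤g ∘ inj₁)) (∑-mono t (f≤g ∘ inj₂)) ∑g≤∑f)) v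

routeLabels-cong : ∀ {A : Set} t {l l′ : Vertex t → Vertex t → A} → (∀ u v → l u v ≡ l′ u v) →
                   ∀ u v → routeLabels t l u v ≡ routeLabels t l′ u v
routeLabels-cong single         l≗ _        _        = refl
routeLabels-cong (join s x t y) l≗ (inj₁ a) (inj₁ b) = routeLabels-cong s (λ _ _ → l≗ _ _) a b
routeLabels-cong (join s x t y) l≗ (inj₂ a) (inj₂ b) = routeLabels-cong t (λ _ _ → l≗ _ _) a b
routeLabels-cong (join s x t y) l≗ (inj₁ a) (inj₂ b) = cong₂ _++_
  (routeLabels-cong s (λ _ _ → l≗ _ _) a x)
  (cong₂ _∷_ (l≗ _ _) (routeLabels-cong t (λ _ _ → l≗ _ _) y b))
routeLabels-cong (join s x t y) l≗ (inj₂ b) (inj₁ a) = cong₂ _++_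
  (routeLabels-cong t (λ _ _ → l≗ _ _) b y)
  (cong₂ _∷_ (l≗ _ _) (routeLabels-cong s (λ _ _ → l≗ _ _) x a))

routeLabels-map : ∀ {A B : Set} t (f : A → B) (l : Vertex t → Vertex t → A) u v →
                  routeLabels t (λ a b → f (l a b)) u v ≡ map f (routeLabels t l u v)
routeLabels-map single         f l _        _        = refl
routeLabels-map (join s x t y) f l (inj₁ a) (inj₁ b) = routeLabels-map s f (l on inj₁) a b
routeLabels-map (join s x t y) f l (inj₂ a) (inj₂ b) = routeLabels-map t f (l on inj₂) a b
routeLabels-map (join s x t y) f l (inj₁ a) (inj₂ b) = trans
  (cong₂ (λ ps qs → ps ++ f (l _ _) ∷ qs) (routeLabels-map s f (l on inj₁) a x) (routeLabels-map t f (l on inj₂) y b))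
  (sym (map-++ f (routeLabels s (l on inj₁) a x) _))
routeLabels-map (join s x t y) f l (inj₂ b) (inj₁ a) = trans
  (cong₂ (λ ps qs → ps ++ f (l _ _) ∷ qs) (routeLabels-map t f (l on inj₂) b y) (routeLabels-map s f (l on inj₁) x a))
  (sym (map-++ f (routeLabels t (l on inj₂) b y) _))

length-routeLabels : ∀ {A : Set} t (l l′ : Vertex t → Vertex t → A) u v →
                     length (routeLabels t l u v) ≡ length (routeLabels t l′ u v)
length-routeLabels t l l′ u v = begin
  length (routeLabels t l u v)                    ≡⟨ length-map _ (routeLabels t l u v) ⟨
  length (map (λ _ → tt) (routeLabels t l u v))   ≡⟨ cong length (routeLabels-map t (λ _ → tt) l u v) ⟨
  length (routeLabels t (λ _ _ → tt) u v)         ≡⟨ cong length (routeLabels-map t (λ _ → tt) l′ u v) ⟩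
  length (map (λ _ → tt) (routeLabels t l′ u v))  ≡⟨ length-map _ (routeLabels t l′ u v) ⟩
  length (routeLabels t l′ u v)                   ∎
  where open ≡-Reasoning

module Saturation (K : ℕ) where

  Δ : ℕ
  Δ = 3 + K

  open Periodic Δ

  Labels : Tree → Set
  Labels t = Vertex t → Vertex t → Fin Δ

  -- The entry of D at (u , v): the distance plus the slack K, or the duration under l if it is larger.
  cap : ∀ t → Labels t → Vertex t → Vertex t → ℕ
  cap t l u v = (length (routeLabels t l u v) + K) ⊔ suc (waits (routeLabels t l u v))

  Meets : ∀ t → Labels t → Labels t → Set
  Meets t l l₀ = ∀ u v → suc (waits (routeLabels t l u v)) ≤ cap t l₀ u v

  minimal : ∀ t → ∃[ l₀ ] (∀ l → Meets t l l₀ → ∀ u v → cap t l₀ u v ≤ cap t l u v)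
  minimal t = decode M₀ , reflects
    where
    decode : Table t (Table t (Fin Δ)) → Labels t
    decode M u v = lookup t (lookup t M u) v

    cost : Labels t → ℕ
    cost l = ∑ t λ u → ∑ t (cap t l u)

    least : ∃[ M ] (∀ M′ → cost (decode M) ≤ cost (decode M′))
    least = argmin (search-Table t (search-Table t any?)) (cost ∘ decode) (table t λ _ → table t λ _ → zero)

    M₀ : Table t (Table t (Fin Δ))
    M₀ = proj₁ least

    cost-≤ : ∀ l → cost (decode M₀) ≤ cost l
    cost-≤ l = ≤-trans (proj₂ least M) (∑-mono t λ u → ∑-mono t λ v → ≤-reflexive
      (cong (λ ps → (length ps + K) ⊔ suc (waits ps)) (routeLabels-cong t decode-M u v)))
      where
      M : Table t (Table t (Fin Δ))
      M = table t λ u → table t (l u)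
      decode-M : ∀ u v → decode M u v ≡ l u v
      decode-M u v = trans (cong (λ row → lookup t row v) (lookup-table t _ u)) (lookup-table t (l u) v)

    reflects : ∀ l → Meets t l (decode M₀) → ∀ u v → cap t (decode M₀) u v ≤ cap t l u v
    reflects l meets u =
      ∑-reflects-≥ t (cap-≤ u) (∑-reflects-≥ t (∑-mono t ∘ cap-≤) (cost-≤ l) u)
      where
      cap-≤ : ∀ u v → cap t l u v ≤ cap t (decode M₀) u v
      cap-≤ u v = ⊔-lub
        (≤-trans (≤-reflexive (cong (_+ K) (length-routeLabels t l (decode M₀) u v))) (m≤m⊔n _ _))
        (meets u v)

  Congested : Tree → Set
  Congested t = ∀ (l : Labels t) → ∃[ u ] ∃[ v ] length (routeLabels t l u v) + K ≤ waits (routeLabels t l u v)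

  record Saturated (t : Tree) : Set where
    field
      l₀        : Labels t
      p q       : Vertex t
      congested : length (routeLabels t l₀ p q) + K ≤ waits (routeLabels t l₀ p q)
      saturated : ∀ l → Meets t l l₀ → waits (routeLabels t l₀ p q) ≤ waits (routeLabels t l p q)

  congested⇒saturated : ∀ t → Congested t → Saturated t
  congested⇒saturated t cong-t = record
    { l₀ = l₀ ; p = p ; q = q ; congested = congested ; saturated = saturated }
    where
    l₀ : Labels t
    l₀ = proj₁ (minimal t)
    p q : Vertex t
    p = proj₁ (cong-t l₀)
    q = proj₁ (proj₂ (cong-t l₀))
    congested : length (routeLabels t l₀ p q) + K ≤ waits (routeLabels t l₀ p q)
    congested = proj₂ (proj₂ (cong-t l₀))
    saturated : ∀ l → Meets t l l₀ → waits (routeLabels t l₀ p q) ≤ waits (routeLabels t l p q)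
    saturated l meets = ≮⇒≥ λ lower → <⇒≱
      (⊔-pres-<m (s≤s (≤-trans (≤-reflexive (cong (_+ K) (length-routeLabels t l l₀ p q))) congested))
        (s≤s lower))
      (≤-trans (m≤n⊔m (length (routeLabels t l₀ p q) + K) _) (proj₂ (minimal t) l meets p q))

  Rooted : Set
  Rooted = Σ Tree Vertex

  Color : Set
  Color = Fin Δ × Fin Δ

  -- The edge at the leaf a carries α inwards and β outwards, and a has distance suc h from the root.
  Hook : (R : Rooted) → Labels (proj₁ R) → ℕ → Color → Set
  Hook (t , r) l h (α , β) = ∃[ a ] ∃[ ps ] ∃[ qs ]
    (routeLabels t l a r ≡ α ∷ ps × length ps ≡ h × routeLabels t l r a ≡ qs ++ β ∷ [] × length qs ≡ h)

  Link : ∀ t → Labels t → ℕ → Fin Δ → Fin Δ → Set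
  Link t l n α β = ∃[ u ] ∃[ v ] ∃[ ps ] (routeLabels t l u v ≡ α ∷ ps ++ β ∷ [] × length ps ≡ n)

  attach : Rooted → Rooted → Rooted
  attach (s , x) (t , y) = join s x t y , inj₁ x

  bouquet : ℕ → Rooted → Rooted
  bouquet zero    R = single , tt
  bouquet (suc n) R = attach (bouquet n R) R

  tower : ℕ → ℕ → Rooted
  tower n zero    = attach (single , tt) (single , tt)
  tower n (suc h) = bouquet n (tower n h)

  record Monochromatic (R : Rooted) (h : ℕ) (l : Labels (proj₁ R)) : Set where
    field
      color : Color
      hook  : Hook R l h color
      link  : ∀ {s} → s < h → Link (proj₁ R) l (s + suc (suc s)) (proj₁ color) (proj₂ color)

  record Coloring (n : ℕ) (R : Rooted) (h : ℕ) (l : Labels (proj₁ (bouquet n R))) : Set where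
    field
      color  : Fin n → Color
      hook   : ∀ i → Hook (bouquet n R) l (suc h) (color i)
      within : ∀ i {s} → s < h →
               Link (proj₁ (bouquet n R)) l (s + suc (suc s)) (proj₁ (color i)) (proj₂ (color i))
      across : ∀ {i j} → i Fin.< j →
               Link (proj₁ (bouquet n R)) l (h + suc (suc h)) (proj₁ (color i)) (proj₂ (color j))

  module _ {R : Rooted} {h : ℕ} (mono : ∀ l → Monochromatic R h l) where

    coloring : ∀ n l → Coloring n R h l
    coloring zero    l = record { color = λ () ; hook = λ () ; within = λ () ; across = λ {} }
    coloring (suc n) l = record
      { color = color′ ; hook = hook′ ; within = within′ ; across = across′ }
      where
      open Monochromatic (mono (l on inj₂))
      module Old = Coloring (coloring n (l on inj₁))
      s t : Tree
      s = proj₁ (bouquet n R)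
      t = proj₁ R
      x : Vertex s
      x = proj₂ (bouquet n R)
      y : Vertex t
      y = proj₂ R
      color′ : Fin (suc n) → Color
      color′ zero    = color
      color′ (suc i) = Old.color i
      hook′ : ∀ i → Hook (bouquet (suc n) R) l (suc h) (color′ i)
      hook′ (suc i) with Old.hook i
      ... | a , rest = inj₁ a , rest
      hook′ zero with hook
      ... | a , ps , qs , up , refl , down , len =
        inj₂ a , ps ++ l (inj₂ y) (inj₁ x) ∷ [] , l (inj₁ x) (inj₂ y) ∷ qs ,
        cong₂ (λ us vs → us ++ l (inj₂ y) (inj₁ x) ∷ vs) up (routeLabels-refl s (l on inj₁) x) ,
        trans (length-++ ps) (+-comm _ 1) ,
        cong₂ (λ us vs → us ++ l (inj₁ x) (inj₂ y) ∷ vs) (routeLabels-refl s (l on inj₁) x) down ,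
        cong suc len
      within′ : ∀ i {m} → m < h →
        Link (join s x t y) l (m + suc (suc m)) (proj₁ (color′ i)) (proj₂ (color′ i))
      within′ zero m<h with link m<h
      ... | u , v , rest = inj₂ u , inj₂ v , rest
      within′ (suc i) m<h with Old.within i m<h
      ... | u , v , rest = inj₁ u , inj₁ v , rest
      across′ : ∀ {i j} → i Fin.< j →
        Link (join s x t y) l (h + suc (suc h)) (proj₁ (color′ i)) (proj₂ (color′ j))
      across′ {suc i} {suc j} (s≤s i<j) with Old.across i<j
      ... | u , v , rest = inj₁ u , inj₁ v , rest
      across′ {zero} {suc j} _ with hook | Old.hook j
      ... | a , ps , _ , up , refl , _ | b , _ , qs , _ , _ , down , len =
        inj₂ a , inj₁ b , ps ++ l (inj₂ y) (inj₁ x) ∷ qs ,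
        trans (cong₂ (λ us vs → us ++ l (inj₂ y) (inj₁ x) ∷ vs) up down)
          (cong (_ ∷_) (sym (++-assoc ps _ _))) ,
        trans (length-++ ps) (cong (λ m → length ps + suc m) len)

    bouquet-monochromatic : ∀ {n} → Δ * Δ < n → ∀ l → Monochromatic (bouquet n R) (suc h) l
    bouquet-monochromatic {n} ΔΔ<n l
      with pigeonhole ΔΔ<n (λ i → let α , β = Coloring.color (coloring n l) i in combine α β)
    ... | i , j , i<j , eq = record
      { color = color i
      ; hook  = hook i
      ; link  = λ { {s} (s≤s s≤h) → link s≤h }
      }
      where
      open Coloring (coloring n l)
      same : proj₂ (color j) ≡ proj₂ (color i)
      same = sym (proj₂ (combine-injective (proj₁ (color i)) (proj₂ (color i)) (proj₁ (color j)) (proj₂ (color j)) eq))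
      link : ∀ {s} → s ≤ h →
             Link (proj₁ (bouquet n R)) l (s + suc (suc s)) (proj₁ (color i)) (proj₂ (color i))
      link {s} s≤h with m≤n⇒m<n∨m≡n s≤h
      ... | inj₁ s<h  = within i s<h
      ... | inj₂ refl = subst (Link (proj₁ (bouquet n R)) l _ (proj₁ (color i))) same (across i<j)

  tower-monochromatic : ∀ {n} → Δ * Δ < n → ∀ h l → Monochromatic (tower n h) h l
  tower-monochromatic ΔΔ<n zero l = record
    { color = l (inj₂ tt) (inj₁ tt) , l (inj₁ tt) (inj₂ tt)
    ; hook  = inj₂ tt , [] , [] , refl , refl , refl , refl
    ; link  = λ () }
  tower-monochromatic ΔΔ<n (suc h) l = bouquet-monochromatic (tower-monochromatic ΔΔ<n h) ΔΔ<n l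

  halve : ∀ n → ∃[ s ] (s + s ≤ n × n ≤ suc (s + s))
  halve zero          = 0 , z≤n , z≤n
  halve (suc zero)    = 0 , z≤n , s≤s z≤n
  halve (suc (suc n)) with halve n
  ... | s , lower , upper = suc s , subst (_≤ suc (suc n)) (cong suc (sym (+-suc s s))) (s≤s (s≤s lower)) ,
    subst (λ m → suc (suc n) ≤ suc (suc m)) (sym (+-suc s s)) (s≤s (s≤s upper))

  -- An excess in [0, K] excludes two consecutive residues, one of which has the parity that the
  -- excesses of the links run through.
  tower-congested : ∀ {n h} → Δ * Δ < n → Δ ≤ h → Congested (proj₁ (tower n h))
  tower-congested {n} {h} ΔΔ<n Δ≤h l with tower-monochromatic ΔΔ<n h l
  ... | record { color = α , β ; link = link } with halve (pred (wait α β))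
  ... | s , lower , upper with link (≤-trans (≤-<-trans (≤-trans (m≤m+n s s) lower) (wait-≤ α β)) Δ≤h)
  ... | u , v , ps , eq , len = u , v , subst (λ qs → length qs + K ≤ waits qs) (sym eq) (begin
    suc (length (ps ++ β ∷ [])) + K    ≡⟨ cong (λ m → suc m + K) (trans (length-++ ps) (trans (+-comm _ 1) (cong suc len′))) ⟩
    4 + (s + s) + K                    ≡⟨ cong (4 +_) (+-comm (s + s) K) ⟩
    4 + K + (s + s)                    ≡⟨ +-comm (4 + K) (s + s) ⟩
    s + s + suc Δ                      ≤⟨ +-monoˡ-≤ (suc Δ) lower ⟩
    pred (wait α β) + suc Δ            ≡⟨ +-suc (pred (wait α β)) Δ ⟩
    wait α β + Δ                       ≤⟨ longer ⟩
    waits (α ∷ ps ++ β ∷ [])           ∎)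
    where
    open ≤-Reasoning
    len′ : length ps ≡ 2 + (s + s)
    len′ = trans len (trans (+-suc s (suc s)) (cong suc (+-suc s s)))
    shorter : wait α β < waits (α ∷ ps ++ β ∷ [])
    shorter = begin-strict
      wait α β                         ≤⟨ s≤s upper ⟩
      2 + (s + s)                      ≡⟨ len′ ⟨
      length ps                        <⟨ length-≤-waits-∷ʳ (α ∷ ps) β ⟩
      waits (α ∷ ps ++ β ∷ [])         ∎
    longer : wait α β + Δ ≤ waits (α ∷ ps ++ β ∷ [])
    longer = +-cancelˡ-≤ (toℕ α) _ _ (≤-trans (≤-reflexive (sym (+-assoc (toℕ α) _ Δ)))
      (congruent-apart (trans (waits-⟶ α ps β) (sym (wait-⟶ α β))) (+-monoʳ-< (toℕ α) shorter)))

module Gadget (c : ℕ) where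

  K : ℕ
  K = suc (c + c)

  open Saturation K
  open Periodic Δ

  wait-mod-suc : ∀ m → wait (m mod Δ) (suc m mod Δ) ≡ 1
  wait-mod-suc m = wait-unique (m mod Δ) (suc m mod Δ) ≤-refl (s≤s z≤n)
    (subst (λ n → m mod Δ ⟶[ 1 ] n mod Δ) (+-comm m 1) (mod-⟶ m 1))

  align-head : ∀ f xs → 0 < length xs → ∃[ n ] waits (f ∷ map (shift n) xs) ≡ suc (waits xs)
  align-head f (x ∷ xs) _ = n , cong₂ _+_ (trans (cong (wait f) aligned) next) (waits-shift n (x ∷ xs))
    where
    n : ℕ
    n = wait x (shift 1 f)
    aligned : shift n x ≡ shift 1 f
    aligned = ⟶-functional x (shift-⟶ n x) (wait-⟶ x (shift 1 f))
    next : wait f (shift 1 f) ≡ 1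
    next = wait-unique f (shift 1 f) ≤-refl (s≤s z≤n) (shift-⟶ 1 f)

  align-last : ∀ g xs → 0 < length xs →
    ∃[ n ] (∀ ys → waits (map (shift n) xs ++ g ∷ ys) ≡ waits xs + suc (waits (g ∷ ys)))
  align-last g (x ∷ []) _ = n , λ ys →
    cong (_+ waits (g ∷ ys)) (trans (cong (λ p → wait p g) aligned) next)
    where
    g⁻ : Fin Δ
    g⁻ = shift (2 + K) g
    n : ℕ
    n = wait x g⁻
    aligned : shift n x ≡ g⁻
    aligned = ⟶-functional x (shift-⟶ n x) (wait-⟶ x g⁻)
    next : wait g⁻ g ≡ 1
    next = wait-unique g⁻ g ≤-refl (s≤s z≤n) (⟶-cancelˡ g g⁻ g (shift-⟶ (2 + K) g)
      (trans (cong (λ m → (toℕ g + m) % Δ) (+-comm (2 + K) 1)) (trans ([m+n]%n≡m%n (toℕ g) Δ) (toℕ-% g))))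
  align-last g (x ∷ x′ ∷ xs) _ with align-last g (x′ ∷ xs) z<s
  ... | n , eq = n , λ ys → trans (cong₂ _+_ (wait-shift n x x′) (eq ys)) (sym (+-assoc (wait x x′) _ _))

  -- A path with n edges from the root to a vertex with the two leaves entry and exit.
  leg : ℕ → Rooted
  leg zero    = attach (attach (single , tt) (single , tt)) (single , tt)
  leg (suc n) = attach (single , tt) (leg n)

  entry exit : ∀ n → Vertex (proj₁ (leg n))
  entry zero    = inj₁ (inj₂ tt)
  entry (suc n) = inj₂ (entry n)
  exit zero    = inj₂ tt
  exit (suc n) = inj₂ (exit n)

  record LegLabels (n : ℕ) (l : Labels (proj₁ (leg n))) : Set where
    field
      α β     : Fin Δ
      ps qs   : List (Fin Δ)
      upward   : routeLabels (proj₁ (leg n)) l (entry n) (proj₂ (leg n)) ≡ α ∷ ps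
      downward : routeLabels (proj₁ (leg n)) l (proj₂ (leg n)) (exit n) ≡ qs ++ β ∷ []
      turn     : routeLabels (proj₁ (leg n)) l (entry n) (exit n) ≡ α ∷ β ∷ []
      length-ps : length ps ≡ n
      length-qs : length qs ≡ n

  legLabels : ∀ n l → LegLabels n l
  legLabels zero    l = record
    { ps = [] ; qs = [] ; upward = refl ; downward = refl ; turn = refl ; length-ps = refl ; length-qs = refl }
  legLabels (suc n) l = record
    { upward    = cong (_++ l (inj₂ (proj₂ (leg n))) (inj₁ tt) ∷ []) upward
    ; downward  = cong (l (inj₁ tt) (inj₂ (proj₂ (leg n))) ∷_) downward
    ; turn      = turn
    ; length-ps = trans (length-++ ps) (trans (+-comm (length ps) 1) (cong suc length-ps))
    ; length-qs = cong suc length-qs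
    }
    where open LegLabels (legLabels n (l on inj₂))

  labelJoin : ∀ {A B C : Set} → (A → A → C) → (B → B → C) → C → C → A ⊎ B → A ⊎ B → C
  labelJoin l m out back (inj₁ a) (inj₁ b) = l a b
  labelJoin l m out back (inj₂ a) (inj₂ b) = m a b
  labelJoin l m out back (inj₁ a) (inj₂ b) = out
  labelJoin l m out back (inj₂ b) (inj₁ a) = back

  labelSingle : Labels single
  labelSingle _ _ = zero

  -- Away from the root the labels are m, m + 1, …, and towards the root 0, 1, …, n, so that no route
  -- to or from the root has any excess.  For n = m, the first edge carries the same label twice.
  labelLeg : ∀ n → ℕ → Labels (proj₁ (leg n))
  labelLeg zero    m = labelJoin (labelJoin labelSingle labelSingle (m mod Δ) (0 mod Δ)) labelSingle (m mod Δ) (0 mod Δ)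
  labelLeg (suc n) m = labelJoin labelSingle (labelLeg n (suc m)) (m mod Δ) (suc n mod Δ)

  upward-waits : ∀ n m zs →
    waits (routeLabels (proj₁ (leg n)) (labelLeg n m) (entry n) (proj₂ (leg n)) ++ (suc n mod Δ) ∷ zs)
      ≡ suc n + waits ((suc n mod Δ) ∷ zs)
  upward-waits zero    m zs = cong (_+ waits ((1 mod Δ) ∷ zs)) (wait-mod-suc 0)
  upward-waits (suc n) m zs = begin
    waits ((up ++ (suc n mod Δ) ∷ []) ++ (suc (suc n) mod Δ) ∷ zs)       ≡⟨ cong waits (++-assoc up _ _) ⟩
    waits (up ++ (suc n mod Δ) ∷ (suc (suc n) mod Δ) ∷ zs)               ≡⟨ upward-waits n (suc m) _ ⟩
    suc n + (wait (suc n mod Δ) (suc (suc n) mod Δ) + rest)              ≡⟨ cong (λ w → suc n + (w + rest)) (wait-mod-suc (suc n)) ⟩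
    suc n + suc rest                                               ≡⟨ +-suc (suc n) rest ⟩
    2 + n + rest                                                   ∎
    where
    open ≡-Reasoning
    up : List (Fin Δ)
    up = routeLabels (proj₁ (leg n)) (labelLeg n (suc m)) (entry n) (proj₂ (leg n))
    rest : ℕ
    rest = waits ((suc (suc n) mod Δ) ∷ zs)

  downward-waits : ∀ n m →
    waits ((m mod Δ) ∷ routeLabels (proj₁ (leg n)) (labelLeg n (suc m)) (proj₂ (leg n)) (exit n)) ≡ suc n
  downward-waits zero    m = trans (+-identityʳ _) (wait-mod-suc m)
  downward-waits (suc n) m = cong₂ _+_ (wait-mod-suc m) (downward-waits n (suc m))

  turn-waits : ∀ n m → 1 ≤ m + n → m + n ≤ Δ →
    waits (routeLabels (proj₁ (leg n)) (labelLeg n m) (entry n) (exit n)) ≡ m + n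
  turn-waits zero    m pos small = trans (+-identityʳ _) (trans
    (wait-unique (0 mod Δ) (m mod Δ) (subst (1 ≤_) (+-identityʳ m) pos) (subst (_≤ Δ) (+-identityʳ m) small) (mod-⟶ 0 m))
    (sym (+-identityʳ m)))
  turn-waits (suc n) m pos small = trans
    (turn-waits n (suc m) (s≤s z≤n) (subst (_≤ Δ) (+-suc m n) small)) (sym (+-suc m n))

  module Composite {s : Tree} (S : Saturated s) where
    open Saturated S

    o : Vertex (proj₁ (leg (suc c)))
    o = inj₁ tt

    t : Tree
    t = join (join s q (proj₁ (leg (suc c))) o) (inj₂ o) s p

    e₁ e₂ s₁ s₂ leaf₁ leaf₂ : Vertex t
    e₁ = inj₁ (inj₂ o)
    e₂ = inj₁ (inj₂ (inj₂ (proj₂ (leg c))))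
    s₁ = inj₂ q
    s₂ = inj₁ (inj₁ p)
    leaf₁ = inj₁ (inj₂ (entry (suc c)))
    leaf₂   = inj₁ (inj₂ (exit (suc c)))

    P₀ : List (Fin Δ)
    P₀ = routeLabels s l₀ p q

    w : ℕ
    w = waits P₀

    g f : Fin Δ
    g = c mod Δ
    f = suc (suc c) mod Δ

    P₀-nonempty : 0 < length P₀
    P₀-nonempty = nonempty P₀ congested
      where
      nonempty : ∀ xs → length xs + K ≤ waits xs → 0 < length xs
      nonempty (_ ∷ _) _ = z<s

    head-shift last-shift : ℕ
    head-shift = proj₁ (align-head f P₀ P₀-nonempty)
    last-shift = proj₁ (align-last g P₀ P₀-nonempty)

    labelShift : ℕ → Labels s
    labelShift n u v = shift n (l₀ u v)

    goal : Labels t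
    goal = labelJoin (labelJoin (labelShift last-shift) (labelLeg (suc c) (suc c)) g zero)
      (labelShift head-shift) f zero

    module _ where
      open LegLabels (legLabels (suc c) (labelLeg (suc c) (suc c)))

      length-shifted : ∀ n → length (routeLabels s (labelShift n) p q) ≡ length P₀
      length-shifted n = length-routeLabels s (labelShift n) l₀ p q

      routeLabels-shift : ∀ n u v → routeLabels s (labelShift n) u v ≡ map (shift n) (routeLabels s l₀ u v)
      routeLabels-shift n u v = routeLabels-map s (shift n) l₀ u v

      waits-f : waits (f ∷ routeLabels s (labelShift head-shift) p q) ≡ suc w
      waits-f = trans (cong (λ ps → waits (f ∷ ps)) (routeLabels-shift head-shift p q))
        (proj₂ (align-head f P₀ P₀-nonempty))

      waits-g : ∀ ys → waits (routeLabels s (labelShift last-shift) p q ++ g ∷ ys) ≡ w + suc (waits (g ∷ ys))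
      waits-g ys = trans (cong (λ ps → waits (ps ++ g ∷ ys)) (routeLabels-shift last-shift p q))
        (proj₂ (align-last g P₀ P₀-nonempty) ys)

      wait-g-f : wait g f ≡ 2
      wait-g-f = wait-unique g f (s≤s z≤n) (s≤s (s≤s z≤n))
        (subst (λ n → g ⟶[ 2 ] n mod Δ) (+-comm c 2) (mod-⟶ c 2))

      cap-leaf₁-s₁ : cap t goal leaf₁ s₁ ≤ suc (suc (suc c) + suc w)
      cap-leaf₁-s₁ = ⊔-lub len (≤-reflexive (cong suc (trans
        (upward-waits (suc c) (suc c) _) (cong (suc (suc c) +_) waits-f))))
        where
        open ≤-Reasoning
        len : length (routeLabels t goal leaf₁ s₁) + K ≤ suc (suc (suc c) + suc w)
        len = begin
          length (routeLabels t goal leaf₁ s₁) + K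
            ≡⟨ cong (_+ K) (trans
                (length-++ (routeLabels (proj₁ (leg (suc c))) (labelLeg (suc c) (suc c)) (entry (suc c)) o))
                (cong₂ _+_ (trans (cong length upward) (cong suc length-ps)) (cong suc (length-shifted head-shift)))) ⟩
          suc (suc c) + suc (length P₀) + K     ≡⟨ +-assoc (suc (suc c)) _ K ⟩
          suc (suc c) + suc (length P₀ + K)     ≤⟨ +-monoʳ-≤ (suc (suc c)) (s≤s congested) ⟩
          suc (suc c) + suc w                   ≤⟨ n≤1+n _ ⟩
          suc (suc (suc c) + suc w)             ∎

      cap-s₂-leaf₂ : cap t goal s₂ leaf₂ ≤ suc (w + suc (suc (suc c)))
      cap-s₂-leaf₂ = ⊔-lub len (≤-reflexive (cong suc (trans
        (waits-g _) (cong (λ n → w + suc n) (downward-waits (suc c) c)))))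
        where
        open ≤-Reasoning
        len : length (routeLabels t goal s₂ leaf₂) + K ≤ suc (w + suc (suc (suc c)))
        len = begin
          length (routeLabels t goal s₂ leaf₂) + K
            ≡⟨ cong (_+ K) (trans (length-++ (routeLabels s _ p q))
                (cong₂ (λ m n → m + suc n) (length-shifted last-shift)
                  (trans (cong length downward) (trans (length-++ qs) (trans (+-comm _ 1) (cong suc length-qs)))))) ⟩
          length P₀ + suc (suc (suc c)) + K     ≡⟨ xy∙z≈xz∙y (length P₀) _ K ⟩
          length P₀ + K + suc (suc (suc c))     ≤⟨ +-monoˡ-≤ _ congested ⟩
          w + suc (suc (suc c))                 ≤⟨ n≤1+n _ ⟩
          suc (w + suc (suc (suc c)))           ∎

      cap-s₂-s₁ : cap t goal s₂ s₁ ≤ suc (w + suc (2 + suc w))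
      cap-s₂-s₁ = ⊔-lub len (≤-reflexive (cong suc (trans
        (cong waits (++-assoc (routeLabels s _ p q) _ _))
        (trans (waits-g _) (cong₂ (λ m n → w + suc (m + n)) wait-g-f waits-f)))))
        where
        open ≤-Reasoning
        len : length (routeLabels t goal s₂ s₁) + K ≤ suc (w + suc (2 + suc w))
        len = begin
          length (routeLabels t goal s₂ s₁) + K
            ≡⟨ cong (_+ K) (trans (cong length (++-assoc (routeLabels s _ p q) _ _))
                (trans (length-++ (routeLabels s _ p q))
                (cong₂ (λ m n → m + suc (suc n)) (length-shifted last-shift) (length-shifted head-shift)))) ⟩
          length P₀ + suc (suc (length P₀)) + K ≡⟨ +-assoc (length P₀) _ K ⟩
          length P₀ + suc (suc (length P₀ + K)) ≤⟨ +-mono-≤ (≤-trans (m≤m+n _ K) congested) (s≤s (s≤s congested)) ⟩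
          w + suc (suc w)                       ≤⟨ +-monoʳ-≤ w (s≤s (m≤n+m _ 2)) ⟩
          w + suc (2 + suc w)                   ≤⟨ n≤1+n _ ⟩
          suc (w + suc (2 + suc w))             ∎

      cap-leaf₁-leaf₂ : cap t goal leaf₁ leaf₂ ≤ 2 + K
      cap-leaf₁-leaf₂ = ⊔-lub (≤-reflexive (cong (λ ps → length ps + K) turn)) (≤-reflexive (cong suc (trans
        (turn-waits (suc c) (suc c) (s≤s z≤n) (≤-trans (≤-reflexive (cong suc (+-suc c c))) (m≤n+m _ 2)))
        (cong suc (+-suc c c)))))

    shifted-cap : ∀ n u v → cap s (labelShift n) u v ≡ cap s l₀ u v
    shifted-cap n u v = trans
      (cong (λ ps → (length ps + K) ⊔ suc (waits ps)) (routeLabels-shift n u v))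
      (cong₂ (λ a b → (a + K) ⊔ suc b) 
        (length-map (shift n) (routeLabels s l₀ u v)) (waits-shift n (routeLabels s l₀ u v)))

    module _ (l : Labels t) (meets : Meets t l goal) where

      private
        leg-l : Labels (proj₁ (leg c))
        leg-l a b = l (inj₁ (inj₂ (inj₂ a))) (inj₁ (inj₂ (inj₂ b)))
        l₁ l₂ : Labels s
        l₁ a b = l (inj₂ a) (inj₂ b)
        l₂ a b = l (inj₁ (inj₁ a)) (inj₁ (inj₁ b))
        P₁ P₂ : List (Fin Δ)
        P₁ = routeLabels s l₁ p q
        P₂ = routeLabels s l₂ p q
        F G X Y : Fin Δ
        F = l (inj₁ (inj₂ o)) (inj₂ p)
        G = l (inj₁ (inj₁ q)) (inj₁ (inj₂ o))
        X = l e₁ e₂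
        Y = l e₂ e₁
        open LegLabels (legLabels c leg-l)

      saturated₁ : w ≤ waits P₁
      saturated₁ = saturated l₁ λ u v → ≤-trans (meets (inj₂ u) (inj₂ v)) (≤-reflexive (shifted-cap head-shift u v))

      saturated₂ : w ≤ waits P₂
      saturated₂ = saturated l₂ λ u v →
        ≤-trans (meets (inj₁ (inj₁ u)) (inj₁ (inj₁ v))) (≤-reflexive (shifted-cap last-shift u v))

      P₁-nonempty : 0 < length P₁
      P₁-nonempty = subst (0 <_) (length-routeLabels s l₀ l₁ p q) P₀-nonempty

      P₂-nonempty : 0 < length P₂
      P₂-nonempty = subst (0 <_) (length-routeLabels s l₀ l₂ p q) P₀-nonempty

      waits-F : suc w ≤ waits (F ∷ P₁)
      waits-F = go P₁ P₁-nonempty saturated₁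
        where
        go : ∀ xs → 0 < length xs → w ≤ waits xs → suc w ≤ waits (F ∷ xs)
        go (x ∷ xs) _ w≤ = +-mono-≤ {1} (s≤s z≤n) w≤

      waits-G : ∀ ys → w + suc (waits (G ∷ ys)) ≤ waits (P₂ ++ G ∷ ys)
      waits-G ys = go P₂ P₂-nonempty saturated₂
        where
        go : ∀ xs → 0 < length xs → w ≤ waits xs → w + suc (waits (G ∷ ys)) ≤ waits (xs ++ G ∷ ys)
        go (x ∷ xs) _ w≤ = ≤-trans (+-monoˡ-≤ _ w≤) (waits-++-≥ x xs G ys)

      bound : ∀ u v {n ps} → cap t goal u v ≤ suc n → routeLabels t l u v ≡ ps → waits ps ≤ n
      bound u v cap≤ refl = s≤s⁻¹ (≤-trans (meets u v) cap≤)

      inward : waits (α ∷ ps ++ Y ∷ []) ≤ suc c × wait Y F ≤ 1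
      inward = let m≤ , n≤ = +-reflects-≥ lower₁ (+-mono-≤ {1} {wait Y F} (s≤s z≤n) waits-F) upper
               in m≤ , +-cancelʳ-≤ (suc w) _ _ (≤-trans (+-monoʳ-≤ (wait Y F) waits-F) n≤)
        where
        lower₁ : suc c ≤ waits (α ∷ ps ++ Y ∷ [])
        lower₁ = subst (λ n → suc n ≤ waits (α ∷ ps ++ Y ∷ [])) length-ps (length-≤-waits-∷ʳ (α ∷ ps) Y)
        upper : waits (α ∷ ps ++ Y ∷ []) + (wait Y F + waits (F ∷ P₁)) ≤ suc c + (1 + suc w)
        upper = ≤-trans (≤-reflexive (sym (waits-split (α ∷ ps) Y (F ∷ P₁))))
          (≤-trans (bound leaf₁ s₁ cap-leaf₁-s₁ (trans
              (cong (λ us → (us ++ Y ∷ []) ++ F ∷ P₁) upward) (++-assoc (α ∷ ps) _ _)))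
            (≤-reflexive (sym (+-suc (suc c) (suc w)))))

      outward : wait G X ≤ 1 × waits (X ∷ qs ++ β ∷ []) ≤ suc c
      outward = +-reflects-≥ {1} (s≤s z≤n) lower (s≤s⁻¹ (+-cancelˡ-≤ w _ _
        (≤-trans (waits-G _) (bound s₂ leaf₂ cap-s₂-leaf₂ (cong (λ us → P₂ ++ G ∷ X ∷ us) downward)))))
        where
        lower : suc c ≤ waits (X ∷ qs ++ β ∷ [])
        lower = subst (λ n → suc n ≤ waits (X ∷ qs ++ β ∷ [])) length-qs (length-≤-waits-∷ʳ (X ∷ qs) β)

      crossing : wait G F ≤ 2
      crossing = +-cancelʳ-≤ (suc w) _ _ (≤-trans (+-monoʳ-≤ (wait G F) waits-F) (s≤s⁻¹ (+-cancelˡ-≤ w _ _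
        (≤-trans (waits-G _) (bound s₂ s₁ cap-s₂-s₁ (++-assoc P₂ _ _))))))

      turning : wait α β ≤ suc K
      turning = ≤-trans (m≤m+n _ 0) (bound leaf₁ leaf₂ cap-leaf₁-leaf₂ turn)

      ⟶-of : ∀ x y {n} → wait x y ≤ n → n ≤ wait x y → x ⟶[ n ] y
      ⟶-of x y ≤n n≤ = subst (x ⟶[_] y) (≤-antisym ≤n n≤) (wait-⟶ x y)

      Y⟶F : Y ⟶[ 1 ] F
      Y⟶F = ⟶-of Y F (proj₂ inward) (s≤s z≤n)

      G⟶X : G ⟶[ 1 ] X
      G⟶X = ⟶-of G X (proj₁ outward) (s≤s z≤n)

      α⟶Y : α ⟶[ suc c ] Y
      α⟶Y = subst (α ⟶[_] Y) (≤-antisym (proj₁ inward)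
        (subst (λ n → suc n ≤ waits (α ∷ ps ++ Y ∷ [])) length-ps (length-≤-waits-∷ʳ (α ∷ ps) Y))) (waits-⟶ α ps Y)

      X⟶β : X ⟶[ suc c ] β
      X⟶β = subst (X ⟶[_] β) (≤-antisym (proj₂ outward)
        (subst (λ n → suc n ≤ waits (X ∷ qs ++ β ∷ [])) length-qs (length-≤-waits-∷ʳ (X ∷ qs) β))) (waits-⟶ X qs β)

      enforced : X ≡ Y
      enforced with m≤n⇒m<n∨m≡n crossing
      ... | inj₂ wait≡2 = ⟶-injective X Y F
        (⟶-cancelˡ G X F {1} {1} G⟶X (subst (G ⟶[_] F) wait≡2 (wait-⟶ G F))) Y⟶F
      ... | inj₁ (s≤s wait≤1) = contradiction turning (<⇒≱ (subst (suc K <_) (sym full) ≤-refl))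
        where
        X≡F : X ≡ F
        X≡F = ⟶-functional G G⟶X (⟶-of G F wait≤1 (s≤s z≤n))
        round : suc c + (1 + suc c) ≡ 2 + K
        round = cong suc (trans (+-suc c (suc c)) (cong suc (+-suc c c)))
        full : wait α β ≡ 2 + K
        full = wait-unique α β (s≤s z≤n) (n≤1+n _) (subst (α ⟶[_] β) round
          (⟶-trans α Y β α⟶Y (⟶-trans Y F β Y⟶F (subst (_⟶[ suc c ] β) X≡F X⟶β))))

abstract
  saturatedTree : ∀ K → ∃ (Saturation.Saturated K)
  saturatedTree K = _ , congested⇒saturated _ (tower-congested ≤-refl ≤-refl)
    where open Saturation K

EqualityGadget : ℕ → ℕ → Set₁
EqualityGadget Δ k = Σ (DiTTR Δ k) λ I → let open DiTTR I in
  Realizable × (∃[ e₁ ] ∃[ e₂ ] (Edge e₁ e₂ × EnforcesEqual e₁ e₂))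

module _ (c k : ℕ) (k≤ : k ≤ Gadget.K c) where
  open Gadget c
  open Saturation K
  open Periodic Δ
  open Temporal Δ

  equalityGadget : ∀ {s} → Saturated s → EqualityGadget Δ k
  equalityGadget S = I , (lab₀ , valid) , e₁ , e₂ ,
    bridge⁺ single tt (proj₁ (leg c)) (proj₂ (leg c)) , enforces
    where
    open Composite S

    I : DiTTR Δ k
    I = record
      { tree = graph t ; isTree = isTree t ; D = λ u v → [ cap t goal u v ]
      ; positive = λ u v → [ m≤n⇒m≤o⊔n (length (routeLabels t goal u v) + K) (s≤s z≤n) ]
      ; slack = λ u v _ → length (routeLabels t goal u v) , distance t goal u v ,
                          [ m≤n⇒m≤n⊔o _ (+-monoʳ-≤ (length (routeLabels t goal u v)) k≤) ]
      }

    lab₀ : Labeling (digraph t) Δ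
    lab₀ u v _ = goal u v

    valid : DiTTR.Valid I lab₀
    valid u v u≢v with earliest t lab₀ u≢v
    ... | Q , eq = Q ,
      (λ Q′ → ≤-trans (≤-reflexive eq) (travel-≤-duration t lab₀ Q′)) ,
      [ ≤-trans (≤-reflexive (trans eq (cong (suc ∘ waits) (routeLabels-total t goal u v))))
          (m≤n⊔m (length (routeLabels t goal u v) + K) _) ]

    enforces : DiTTR.EnforcesEqual I e₁ e₂
    enforces lab lab-valid e e′ = trans (sym (total-edge t lab e))
      (trans (enforced (total t lab) meets) (total-edge t lab e′))
      where
      meets : Meets t (total t lab) goal
      meets u v with vertex-≟ t u v
      ... | yes refl = ≤-trans (≤-reflexive (cong (suc ∘ waits) (routeLabels-refl t (total t lab) u)))
                         (m≤n⇒m≤o⊔n (length (routeLabels t goal u u) + K) (s≤s z≤n))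
      ... | no u≢v with lab-valid u v u≢v
      ...   | Q , _ , [ duration≤ ] = ≤-trans (travel-≤-duration t lab Q) duration≤

lemma18 : ∀ (Δ k : ℕ) → 1 ≤ k → k + 3 ≤ Δ → 2 ∣ Δ →
    Σ (DiTTR Δ k) λ I → let open DiTTR I in
    Realizable × (∃[ e₁ ] ∃[ e₂ ] (Edge e₁ e₂ × EnforcesEqual e₁ e₂))
lemma18 Δ k 1≤k k+3≤Δ (divides zero refl) = contradiction (≤-trans (m≤n+m 3 k) k+3≤Δ) λ ()
lemma18 Δ k 1≤k k+3≤Δ (divides (suc zero) refl) = contradiction (≤-trans (m≤n+m 3 k) k+3≤Δ) λ { (s≤s (s≤s ())) }
lemma18 Δ k 1≤k k+3≤Δ (divides (suc (suc c)) refl) = subst (λ n → EqualityGadget n k) (sym Δ≡)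
  (equalityGadget c k (+-cancelʳ-≤ 3 k _ (≤-trans k+3≤Δ (≤-reflexive (trans Δ≡ (+-comm 3 _)))))
    (proj₂ (saturatedTree (Gadget.K c))))
  where
  Δ≡ : suc (suc c) * 2 ≡ 3 + suc (c + c)
  Δ≡ = cong (4 +_) (trans (*-comm c 2) (cong (c +_) (+-identityʳ c)))
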